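{- Let $p$ be a prime and $a,c$ positive integers such that $c$ is a primitive divisor of $p^a-1$. Let $b=2^t r_1^{t_1}\cdots r_s^{t_s}$, where $s\ge 1$, $r_1,\ldots,r_s$ are distinct odd primes, $t\ge 0$ and $t_1,\ldots,t_s\ge 1$, and assume $\gcd(p,b)=1$. Put $b'=r_1^{t_1}\cdots r_s^{t_s}$. Assume $\gcd\big(\tfrac{p^a-1}{c},b\big)=1$ and that for each $i=1,\ldots,s$ the multiplicative order of $p^a$ modulo $r_i^{t_i}$ equals $r_i^{h_i}$ for some $0\le h_i\le t_i-1$. If $t\in\{0,1\}$, or if $t\ge 2$ and $p^a\equiv 1\pmod 4$, then $$g\Big(\tfrac{p^{2^tab'}-1}{2^tb'c},\,p^{2^tab'}\Big)=2^t b'\,g\Big(\tfrac{p^a-1}{c},\,p^a\Big).$$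
   Context: For a prime power $q$ and a positive integer $k$, the Waring number $g(k,q)$ is the smallest $s$ (if it exists) such that every element of $\mathbb{F}_q$ is a sum of $s$ $k$-th powers of elements of $\mathbb{F}_q$. An integer $e$ is a primitive divisor of $p^a-1$ if $e\mid p^a-1$ and $e\nmid p^u-1$ for every $1\le u<a$. -}

module Defs where

open import Algebra.Apartness.Bundles using (HeytingField; module HeytingCommutativeRing)
open import Algebra.Bundles using (CommutativeRing; module Semiring)
import Algebra.Definitions.RawSemiring as RawSemiringDefs
open import Data.Fin.Base using (Fin; zero; suc)
open import Data.Nat.Base
  using (ℕ; zero; suc; NonZero; _*_; _∸_; _^_; _≤_; _<_; ∣_-_∣; +-*-rawSemiring)
open import Data.Nat.Divisibility using (_∣_)
open import Data.Nat.Primality using (Prime; prime⇒nonZero)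
open import Data.Nat.Properties using (m^n≢0; m*n≢0)
open import Data.Product.Base using (_×_; Σ-syntax)
open import Data.Vec.Functional using (Vector)
open import Function.Bundles using (Inverse)
open import Level using (Level; _⊔_) renaming (suc to lsuc)
open import Relation.Binary.PropositionalEquality using (setoid)
open import Relation.Nullary.Negation using (¬_)

open RawSemiringDefs +-*-rawSemiring public using (product)

IsLeast : ∀ {ℓ} → (ℕ → Set ℓ) → ℕ → Set ℓ
IsLeast P n = P n × (∀ k → P k → n ≤ k)

-- The absolute difference, rather than ∸, keeps this a genuine
-- congruence also when x < y.
infix 4 _≡_[mod_]
_≡_[mod_] : ℕ → ℕ → ℕ → Set
x ≡ y [mod m ] = m ∣ ∣ x - y ∣

IsMultiplicativeOrder : (x m n : ℕ) → Set
IsMultiplicativeOrder x m = IsLeast (λ n → 1 ≤ n × x ^ n ≡ 1 [mod m ])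

IsPrimitiveDivisor : (e p a : ℕ) → Set
IsPrimitiveDivisor e p a =
  e ∣ p ^ a ∸ 1 × (∀ u → 1 ≤ u → u < a → ¬ e ∣ p ^ u ∸ 1)

-- The enumeration makes _≈_ and invertibility decidable, so the
-- apartness relation of the Heyting field is just the negation of _≈_
-- and every element other than 0# is invertible; 1# is not 0#, since
-- invertible elements are apart from 0#.
record FiniteField c ℓ₁ ℓ₂ (q : ℕ) : Set (lsuc (c ⊔ ℓ₁ ⊔ ℓ₂)) where
  field
    heytingField : HeytingField c ℓ₁ ℓ₂

  open HeytingField heytingField using (heytingCommutativeRing)

  commutativeRing : CommutativeRing c ℓ₁
  commutativeRing = HeytingCommutativeRing.commutativeRing heytingCommutativeRing

  field
    enumeration : Inverse (CommutativeRing.setoid commutativeRing) (setoid (Fin q))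

module _ {c ℓ₁ ℓ₂ : Level} {q : ℕ} (F : FiniteField c ℓ₁ ℓ₂ q) where
  open CommutativeRing (FiniteField.commutativeRing F) using (Carrier; _≈_; semiring)
  open RawSemiringDefs (Semiring.rawSemiring semiring) using (sum)
    renaming (_^_ to _^ᶠ_)

  EveryElementIsSumOfPowers : (k s : ℕ) → Set (c ⊔ ℓ₁)
  EveryElementIsSumOfPowers k s =
    ∀ (x : Carrier) → Σ[ y ∈ Vector Carrier s ] x ≈ sum (λ i → y i ^ᶠ k)

  -- IsWaringNumber F k s says that g(k, q) exists and equals s.  The
  -- value does not depend on F, as fields of order q are isomorphic.
  IsWaringNumber : (k s : ℕ) → Set (c ⊔ ℓ₁)
  IsWaringNumber k = IsLeast (EveryElementIsSumOfPowers k)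

primePowers : ∀ {n} → Vector ℕ n → Vector ℕ n → ℕ
primePowers r e = product (λ i → r i ^ e i)

primePowers≢0 : ∀ {n} (r e : Vector ℕ n) → (∀ i → Prime (r i)) →
                NonZero (primePowers r e)
primePowers≢0 {zero}  r e r-prime = _
primePowers≢0 {suc n} r e r-prime =
  m*n≢0 (r zero ^ e zero) _
    {{m^n≢0 (r zero) (e zero) {{prime⇒nonZero (r-prime zero)}}}}
    {{primePowers≢0 (λ i → r (suc i)) (λ i → e (suc i)) (λ i → r-prime (suc i))}}

denominator≢0 : ∀ {n} t (r e : Vector ℕ n) c .{{_ : NonZero c}} →
                (∀ i → Prime (r i)) → NonZero (2 ^ t * primePowers r e * c)
denominator≢0 t r e c r-prime =
  m*n≢0 (2 ^ t * primePowers r e) c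
    {{m*n≢0 (2 ^ t) (primePowers r e) {{m^n≢0 2 t}} {{primePowers≢0 r e r-prime}}}}

-- Let q = pᵃ, Q = qᵇ, k = (q - 1) / c and k′ = (Q - 1) / (b c).
-- The nonzero k-th powers of F_q and the nonzero k′-th powers of F_Q form the
-- cyclic groups of orders c and b c; if θ generates the second one, then its
-- elements are the products θʲ x with 0 ≤ j < b and x a nonzero k-th power in F_q.
-- The degree n of θ over F_q satisfies b c ∣ qⁿ - 1, hence b ∣ 1 + q + ⋯ + qⁿ⁻¹
-- because b is prime to k, and by lifting the exponent b ∣ n.  So 1, θ, …, θᵇ⁻¹
-- is a basis of F_Q over F_q, sums of k′-th powers decompose along it into sums
-- of k-th powers, and the numbers of summands needed add up over the coordinates.
-- That every element of F_q is a sum of k-th powers is the primitivity of c: an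
-- element ζ of order c has degree a over F_p.  The field F_q is found inside F_Q by
-- sending ζ to a root of its minimal polynomial, which divides X^(Q-1) - 1.
module Submission where

open import Defs
open import Algebra.Apartness.Bundles using (HeytingField)
open import Algebra.Bundles using (CommutativeMonoid; CommutativeRing; RawRing; module Semiring)
import Algebra.Definitions.RawSemiring as RawSemiringDefs
import Algebra.Morphism.RingMonomorphism as RingMonomorphism
open import Algebra.Morphism.Structures using (IsRingMonomorphism)
import Algebra.Properties.CommutativeMonoid.Sum as MonoidSum
import Algebra.Properties.CommutativeSemiring.Exp as Exp
import Algebra.Properties.Monoid.Mult as MonoidMult
import Algebra.Properties.Ring as RingProperties
import Algebra.Properties.Semiring.Mult as Mult
import Algebra.Solver.Ring.NaturalCoefficients.Default as SemiringSolver
open import Algebra.Structures using (IsCommutativeRing)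
open import Data.Empty using (⊥-elim)
open import Data.Fin.Base as Fin using (Fin; zero; suc; punchIn; punchOut; toℕ; fromℕ<; combine; remQuot)
open import Data.Fin.Permutation using (Permutation′; permutation)
open import Data.Fin.Properties as Fin
  using (_≟_; any?; all?; ¬∀⟶∃¬; pigeonhole; injective⇒≤; nonZeroIndex; toℕ<n; toℕ-fromℕ<;
         punchIn-injective; punchInᵢ≢i; punchIn-punchOut; punchOut-injective; remQuot-combine; combine-remQuot)
open import Data.List.Base as List using (List; []; _∷_; length)
open import Data.List.Properties using (length-replicate)
open import Data.List.Relation.Unary.All using ([]; _∷_)
open import Data.Nat.Base as ℕ using (ℕ; zero; suc; _≤_; _<_; s≤s; z≤n; NonZero; _∸_)
open import Data.Nat.Coprimality as Coprimality using (Coprime; coprime-divisor; coprime-Bézout; gcd≡1⇒coprime)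
open import Data.Nat.DivMod using (_mod_; m≡m%n+[m/n]*n; m%n<n; m/n*n≡m)
open import Data.Nat.Divisibility
  using (_∣_; _∤_; divides; _∣?_; ∣⇒≤; m∣m*n; n∣m*n; ∣-refl; ∣-trans; _∣0; 0∣⇒≡0; 1∣_; ∣1⇒≡1; ∣n⇒∣m*n; ∣m⇒∣m*n;
         ∣m+n∣m⇒∣n; ∣m∣n⇒∣m+n; m*n∣⇒m∣; m*n∣⇒n∣; *-pres-∣; *-monoˡ-∣; *-monoʳ-∣; *-cancelˡ-∣; *-cancelʳ-∣;
         quotient-<; quotient≢0; m%n≡0⇒n∣m)
open import Data.Nat.GCD using (gcd; module Bézout)
open import Data.Nat.Induction using (<-rec)
open import Data.Nat.Primality
  using (Prime; prime[2]; ¬prime[0]; prime⇒nonZero; prime⇒nonTrivial; prime⇒irreducible; euclidsLemma)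
open import Data.Nat.Primality.Factorisation using (factorise)
import Data.Nat.Properties as ℕ
open import Data.Nat.Tactic.RingSolver using (solve-∀)
open import Data.Product.Base using (_×_; _,_; ∃-syntax; Σ-syntax; proj₁; proj₂)
open import Data.Sum.Base using (_⊎_; inj₁; inj₂; [_,_]′)
open import Data.Vec.Base as Vec using (Vec; []; _∷_; _∷ʳ_)
open import Data.Vec.Functional using (Vector)
open import Data.Vec.Properties using (∷-injective)
open import Function.Base using (_∘_; case_of_)
open import Function.Bundles using (Inverse)
open import Function.Definitions using (Injective)
open import Level using (0ℓ)
open import Relation.Binary.Definitions using (tri<; tri≈; tri>)
open import Relation.Binary.PropositionalEquality as ≡ using (_≡_; _≢_; refl; sym; trans; cong; cong₂; subst)
open import Relation.Nullary using (¬_; Dec; yes; no; contradiction)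
open import Relation.Nullary.Decidable using (decidable-stable; _×-dec_; ¬?)

-- The order hypothesis enters as r ∣ q - 1 for each odd prime r dividing b, which is what lifting
-- the exponent starts from; at the prime 2 lifting fails for q ≡ 3 (mod 4), whence the condition
-- for t ≥ 2. The lower bound needs one element that is expensive in every coordinate at once: if x
-- in F_q needs all g(k, q) summands, x (1 + θ + ⋯ + θᵇ⁻¹) is such an element, because a k′-th power
-- touches a single coordinate. The two fields are given independently of each other, so that F_q is
-- not a subset of F_Q. Both are first copied onto `Fin`, where equality is decidable and every
-- existence question about elements is a finite search. The prime field is kept as bare operations
-- on `Fin p` with an embedding into each field: one coefficient vector can then be evaluated in
-- both, which carries the relation satisfied by ζ from F_q to F_Q. Dimension is handled by counting
-- vectors.

-- Arithmetic: divisibility, geometric sums, lifting the exponent.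

module NumberTheory where
  open import Data.Nat.Base
  open import Data.Nat.Properties hiding (_≟_)
  open ≡ using (module ≡-Reasoning)

  -- Divisibility and coprimality

  prime≢1 : ∀ {r} → Prime r → r ≢ 1
  prime≢1 r-prime refl = contradiction (prime⇒nonTrivial r-prime) λ ()

  prime∣prime : ∀ {r r′} → Prime r → Prime r′ → r ∣ r′ → r ≡ r′
  prime∣prime r-prime r′-prime r∣r′ =
    [ ⊥-elim ∘ prime≢1 r-prime , (λ eq → eq) ]′ (prime⇒irreducible r′-prime r∣r′)

  prime∣^⇒∣ : ∀ {r m} n → Prime r → r ∣ m ^ n → r ∣ m
  prime∣^⇒∣ zero r-prime r∣ = contradiction (∣1⇒≡1 r∣) (prime≢1 r-prime)
  prime∣^⇒∣ {m = m} (suc n) r-prime r∣ with euclidsLemma m (m ^ n) r-prime r∣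
  ... | inj₁ r∣m  = r∣m
  ... | inj₂ r∣mⁿ = prime∣^⇒∣ n r-prime r∣mⁿ

  ∤⇒coprime : ∀ {r m} → Prime r → r ∤ m → Coprime r m
  ∤⇒coprime r-prime r∤m (d∣r , d∣m) with prime⇒irreducible r-prime d∣r
  ... | inj₁ d≡1  = d≡1
  ... | inj₂ refl = contradiction d∣m r∤m

  coprime-*ˡ : ∀ {l m n} → Coprime l n → Coprime m n → Coprime (l * m) n
  coprime-*ˡ l⊥n m⊥n (d∣lm , d∣n) =
    m⊥n (coprime-divisor (λ (x∣d , x∣l) → l⊥n (x∣l , ∣-trans x∣d d∣n)) d∣lm , d∣n)

  coprime-^ˡ : ∀ {m n} k → Coprime m n → Coprime (m ^ k) n
  coprime-^ˡ {n = n} zero m⊥n = Coprimality.1-coprimeTo n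
  coprime-^ˡ (suc k) m⊥n = coprime-*ˡ m⊥n (coprime-^ˡ k m⊥n)

  coprime-*-∣ : ∀ {m n o} → Coprime m n → m ∣ o → n ∣ o → m * n ∣ o
  coprime-*-∣ {m} {n} m⊥n m∣o (divides x refl) =
    *-monoˡ-∣ n (coprime-divisor m⊥n (subst (m ∣_) (*-comm x n) m∣o))

  primePowers-coprime : ∀ {s m} (r e : Vector ℕ s) → (∀ i → Coprime (r i) m) →
                        Coprime (primePowers r e) m
  primePowers-coprime {zero} {m} r e r⊥m = Coprimality.1-coprimeTo m
  primePowers-coprime {suc s} r e r⊥m =
    coprime-*ˡ (coprime-^ˡ (e zero) (r⊥m zero))
               (primePowers-coprime (r ∘ suc) (e ∘ suc) (r⊥m ∘ suc))

  ^∣primePowers : ∀ {s} (r e : Vector ℕ s) i → r i ^ e i ∣ primePowers r e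
  ^∣primePowers r e zero    = m∣m*n _
  ^∣primePowers r e (suc i) = ∣n⇒∣m*n (r zero ^ e zero) (^∣primePowers (r ∘ suc) (e ∘ suc) i)

  primePowers-∣ : ∀ {s n} (r e : Vector ℕ s) → (∀ i → Prime (r i)) →
                  Injective _≡_ _≡_ r → (∀ i → r i ^ e i ∣ n) → primePowers r e ∣ n
  primePowers-∣ {zero} r e r-prime r-inj ∣n = 1∣ _
  primePowers-∣ {suc s} r e r-prime r-inj ∣n =
    coprime-*-∣ (Coprimality.sym (primePowers-coprime (r ∘ suc) (e ∘ suc) r⊥r₀ᵉ)) (∣n zero)
      (primePowers-∣ (r ∘ suc) (e ∘ suc) (r-prime ∘ suc) (λ eq → case r-inj eq of λ { refl → refl })
        (∣n ∘ suc))
    where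
    r⊥r₀ᵉ : ∀ i → Coprime (r (suc i)) (r zero ^ e zero)
    r⊥r₀ᵉ i = ∤⇒coprime (r-prime (suc i)) λ r∣ →
      case r-inj (prime∣prime (r-prime (suc i)) (r-prime zero)
                   (prime∣^⇒∣ (e zero) (r-prime (suc i)) r∣)) of λ ()

  maximal-power : ∀ {r} → Prime r → ∀ n → .{{NonZero n}} → ∃[ e ] ∃[ m ] n ≡ r ^ e * m × r ∤ m
  maximal-power {r} r-prime n = <-rec P step n
    where
    instance _ = prime⇒nonTrivial r-prime
    P : ℕ → Set
    P n = .{{NonZero n}} → ∃[ e ] ∃[ m ] n ≡ r ^ e * m × r ∤ m
    step : ∀ n → (∀ {m} → m < n → P m) → P n
    step n rec with r ∣? n
    ... | no  r∤n = 0 , n , sym (*-identityˡ n) , r∤n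
    ... | yes r∣n@(divides m n≡mr) =
      let e , m′ , m≡ , r∤m′ = rec (quotient-< r∣n) {{quotient≢0 r∣n}}
      in  suc e , m′ , trans n≡mr (trans (*-comm m r) (trans (cong (r *_) m≡) (sym (*-assoc r (r ^ e) m′)))) , r∤m′

  -- Geometric sums

  -- This is (qⁿ - 1) / (q - 1) in Horner form, without division or subtraction.
  geometricSum : ℕ → ℕ → ℕ
  geometricSum q zero    = 0
  geometricSum q (suc n) = 1 + q * geometricSum q n

  suc-^ : ∀ x n → suc x ^ n ≡ suc (x * geometricSum (suc x) n)
  suc-^ x zero = cong suc (sym (*-zeroʳ x))
  suc-^ x (suc n) rewrite suc-^ x n = lemma x (geometricSum (suc x) n)
    where
    lemma : ∀ x g → suc x * suc (x * g) ≡ suc (x * suc (suc x * g))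
    lemma = solve-∀

  geometricSum-+ : ∀ q m n → geometricSum q (m + n) ≡ geometricSum q m + q ^ m * geometricSum q n
  geometricSum-+ q zero n = sym (*-identityˡ _)
  geometricSum-+ q (suc m) n rewrite geometricSum-+ q m n =
    lemma q (geometricSum q m) (q ^ m) (geometricSum q n)
    where
    lemma : ∀ q x y z → suc (q * (x + y * z)) ≡ suc (q * x) + q * y * z
    lemma = solve-∀

  geometricSum-* : ∀ q m n → geometricSum q (m * n) ≡ geometricSum q m * geometricSum (q ^ m) n
  geometricSum-* q m zero rewrite *-zeroʳ m = sym (*-zeroʳ (geometricSum q m))
  geometricSum-* q m (suc n)
    rewrite *-suc m n | geometricSum-+ q m (m * n) | geometricSum-* q m n =
    lemma (geometricSum q m) (q ^ m) (geometricSum (q ^ m) n)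
    where
    lemma : ∀ x y z → x + y * (x * z) ≡ x * suc (y * z)
    lemma = solve-∀

  -- Each of the n terms is 1 modulo d.
  geometricSum-≡n : ∀ d x n → ∃[ z ] geometricSum (suc (d * x)) n ≡ n + d * z
  geometricSum-≡n d x zero = 0 , sym (*-zeroʳ d)
  geometricSum-≡n d x (suc n) with geometricSum-≡n d x n
  ... | z , eq rewrite eq = z + x * (n + d * z) , lemma d x n z
    where
    lemma : ∀ d x n z → suc (suc (d * x) * (n + d * z)) ≡ suc n + d * (z + x * (n + d * z))
    lemma = solve-∀

  -- The second-order expansion of ((1 + d x)ⁿ - 1) / (d x), doubled to avoid
  -- the fraction n (n - 1) / 2.
  2*geometricSum : ∀ d x n → ∃[ z ]
    2 * geometricSum (suc (d * x)) (suc n) ≡ 2 * suc n + d * x * n * suc n + d * d * z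
  2*geometricSum d x zero = 0 , lemma d x
    where
    lemma : ∀ d x → 2 * suc (suc (d * x) * 0) ≡ 2 * 1 + d * x * 0 * 1 + d * d * 0
    lemma = solve-∀
  2*geometricSum d x (suc n) with 2*geometricSum d x n
  ... | z , eq = z + d * x * z + x * x * n * suc n , (begin
      2 * suc (suc (d * x) * g)          ≡⟨ lemma₁ (d * x) g ⟩
      2 + suc (d * x) * (2 * g)          ≡⟨ cong (λ y → 2 + suc (d * x) * y) eq ⟩
      2 + suc (d * x) * (2 * suc n + d * x * n * suc n + d * d * z) ≡⟨ lemma₂ d x n z ⟩
      _ ∎)
    where
    open ≡-Reasoning
    g = geometricSum (suc (d * x)) (suc n)
    lemma₁ : ∀ y g → 2 * suc (suc y * g) ≡ 2 + suc y * (2 * g)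
    lemma₁ = solve-∀
    lemma₂ : ∀ d x n z → 2 + suc (d * x) * (2 * suc n + d * x * n * suc n + d * d * z) ≡
      2 * suc (suc n) + d * x * suc n * suc (suc n) + d * d * (z + d * x * z + x * x * n * suc n)
    lemma₂ = solve-∀

  -- The hypothesis under which r divides a geometric sum of ratio q exactly as
  -- often as it divides the number of terms; for r = 2 this fails if q ≡ 3 (mod 4).
  Lifts : ℕ → ℕ → Set
  Lifts r q = (r ≢ 2 × ∃[ x ] q ≡ suc (r * x)) ⊎ (r ≡ 2 × ∃[ x ] q ≡ suc (4 * x))

  lifts⇒≡1 : ∀ {r q} → Lifts r q → ∃[ x ] q ≡ suc (r * x)
  lifts⇒≡1 (inj₁ (_ , q≡)) = q≡
  lifts⇒≡1 (inj₂ (refl , x , refl)) = 2 * x , cong suc (*-assoc 2 2 x)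

  lifts-^ : ∀ {r q} n → Lifts r q → Lifts r (q ^ n)
  lifts-^ {r} n (inj₁ (r≢2 , x , refl)) =
    inj₁ (r≢2 , x * _ , trans (suc-^ (r * x) n) (cong suc (*-assoc r x _)))
  lifts-^ n (inj₂ (r≡2 , x , refl)) =
    inj₂ (r≡2 , x * _ , trans (suc-^ (4 * x) n) (cong suc (*-assoc 4 x _)))

  ∣geometricSum⇒∣ : ∀ {r q} u → (∃[ x ] q ≡ suc (r * x)) → r ∣ geometricSum q u → r ∣ u
  ∣geometricSum⇒∣ {r} u (x , refl) r∣ with geometricSum-≡n r x u
  ... | z , eq = ∣m+n∣m⇒∣n (subst (r ∣_) (trans eq (+-comm u _)) r∣) (m∣m*n z)

  ∣⇒∣geometricSum : ∀ {r q} u → (∃[ x ] q ≡ suc (r * x)) → r ∣ u → r ∣ geometricSum q u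
  ∣⇒∣geometricSum {r} u (x , refl) r∣u with geometricSum-≡n r x u
  ... | z , eq = subst (r ∣_) (sym eq) (∣m∣n⇒∣m+n r∣u (m∣m*n z))

  -- For odd r the doubled expansion, divided by r, reads 2 y ≡ 2 (mod r), so r ∣ y would force r =
  -- 2. For r = 2 the sum is 1 + q = 2 + 4 x.
  geometricSum-exact : ∀ {r q} → Prime r → Lifts r q → ∃[ y ] geometricSum q r ≡ r * y × r ∤ y
  geometricSum-exact {suc r} r-prime (inj₁ (r≢2 , x , refl))
    with 2*geometricSum (suc r) x r | ∣⇒∣geometricSum (suc r) (x , refl) ∣-refl
  ... | z , eq | divides y g≡yr = y , trans g≡yr (*-comm y (suc r)) , λ r∣y →
    r≢2 (prime∣prime r-prime prime[2]
      (∣m+n∣m⇒∣n (subst (suc r ∣_) (trans 2y≡ (+-comm 2 _)) (∣n⇒∣m*n 2 r∣y)) (m∣m*n _)))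
    where
    lemma : ∀ r x z → 2 * suc r + suc r * x * r * suc r + suc r * suc r * z ≡
                      suc r * (2 + suc r * (x * r + z))
    lemma = solve-∀
    lemma′ : ∀ r y → 2 * (y * r) ≡ r * (2 * y)
    lemma′ = solve-∀
    2y≡ : 2 * y ≡ 2 + suc r * (x * r + z)
    2y≡ = *-cancelˡ-≡ _ _ (suc r) (trans (sym (lemma′ (suc r) y))
            (trans (cong (2 *_) (sym g≡yr)) (trans eq (lemma r x z))))
  geometricSum-exact r-prime (inj₂ (refl , x , refl)) =
    suc (2 * x) , lemma x , λ 2∣ →
      prime≢1 r-prime (∣1⇒≡1 (∣m+n∣m⇒∣n (subst (2 ∣_) (+-comm 1 (2 * x)) 2∣) (m∣m*n x)))
    where
    lemma : ∀ x → suc (suc (4 * x) * suc (suc (4 * x) * 0)) ≡ 2 * suc (2 * x)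
    lemma = solve-∀

  -- Induction strips one r at a time: for u = r m the sum factors into `geometricSum q r`, which
  -- contains r exactly once, and `geometricSum (q ^ r) m`, whose ratio satisfies `Lifts` again.
  ^∣geometricSum⇒^∣ : ∀ {r q} e u → Prime r → Lifts r q → r ^ e ∣ geometricSum q u → r ^ e ∣ u
  ^∣geometricSum⇒^∣ zero u r-prime lifts r∣ = 1∣ u
  ^∣geometricSum⇒^∣ {r} {q} (suc e) u r-prime lifts r∣
    with ∣geometricSum⇒∣ u (lifts⇒≡1 lifts) (m*n∣⇒m∣ r (r ^ e) r∣)
  ... | divides m refl with geometricSum-exact r-prime lifts
  ... | y , eq , r∤y = subst (r * r ^ e ∣_) (*-comm r m) (*-monoʳ-∣ r
      (^∣geometricSum⇒^∣ e m r-prime (lifts-^ r lifts)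
        (coprime-divisor (coprime-^ˡ e (∤⇒coprime r-prime r∤y))
          (*-cancelˡ-∣ r {{prime⇒nonZero r-prime}} (subst (r * r ^ e ∣_) eq′ r∣)))))
    where
    eq′ : geometricSum q (m * r) ≡ r * (y * geometricSum (q ^ r) m)
    eq′ rewrite *-comm m r | geometricSum-* q r m | eq = *-assoc r y _

  ^∣geometricSum : ∀ {r q} e → (∃[ x ] q ≡ suc (r * x)) → r ^ e ∣ geometricSum q (r ^ e)
  ^∣geometricSum zero q≡ = 1∣ _
  ^∣geometricSum {r} {q} (suc e) q≡@(x , refl) =
    subst (r * r ^ e ∣_) (sym (geometricSum-* q r (r ^ e)))
      (*-pres-∣ (∣⇒∣geometricSum r q≡ ∣-refl)
                (^∣geometricSum e (x * _ , trans (suc-^ (r * x) r) (cong suc (*-assoc r x _)))))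

  geometricSum-monoʳ-∣ : ∀ q {m n} → m ∣ n → geometricSum q m ∣ geometricSum q n
  geometricSum-monoʳ-∣ q {m} (divides x refl) =
    subst (geometricSum q m ∣_) (trans (sym (geometricSum-* q m x)) (cong (geometricSum q) (*-comm m x)))
      (m∣m*n _)

  ∸1-∣⇒≡suc : ∀ {d n} → .{{NonZero n}} → d ∣ n ∸ 1 → ∃[ x ] n ≡ suc (d * x)
  ∸1-∣⇒≡suc {d} {suc n} (divides x refl) = x , cong suc (*-comm x d)

  ≡1[mod]⇒≡suc : ∀ {d n} → .{{NonZero n}} → n ≡ 1 [mod d ] → ∃[ x ] n ≡ suc (d * x)
  ≡1[mod]⇒≡suc {d} {suc n} d∣ = ∸1-∣⇒≡suc (subst (d ∣_) (∣-∣-identityʳ n) d∣)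

  -- Bézout gives 1 + y n = x m or the same with m and n exchanged; then q ^ (x m) = q · q ^ (y n)
  -- reads 1 = q modulo r.
  ∣^-1∧coprime⇒∣-1 : ∀ {r} q m n → .{{NonZero q}} → Coprime m n → r ∣ q ^ m ∸ 1 → r ∣ q ^ n ∸ 1 → r ∣ q ∸ 1
  ∣^-1∧coprime⇒∣-1 {r} q@(suc q-1) m n m⊥n r∣m r∣n =
    fromBézout (coprime-Bézout m⊥n)
    where
    power : ∀ k l → r ∣ q ^ k ∸ 1 → ∃[ z ] q ^ (l * k) ≡ suc (r * z)
    power k l r∣ with ∸1-∣⇒≡suc {{m^n≢0 q k}} r∣
    ... | z , eq = z * geometricSum _ l , (begin
      q ^ (l * k)      ≡⟨ cong (q ^_) (*-comm l k) ⟩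
      q ^ (k * l)      ≡⟨ ^-*-assoc q k l ⟨
      (q ^ k) ^ l      ≡⟨ cong (_^ l) eq ⟩
      suc (r * z) ^ l  ≡⟨ suc-^ (r * z) l ⟩
      suc (r * z * geometricSum _ l)   ≡⟨ cong suc (*-assoc r z _) ⟩
      suc (r * (z * geometricSum _ l)) ∎)
      where open ≡-Reasoning
    lemma : ∀ x y m n → 1 + y * n ≡ x * m → r ∣ q ^ m ∸ 1 → r ∣ q ^ n ∸ 1 → r ∣ q-1
    lemma x y m n eq r∣m r∣n with power m x r∣m | power n y r∣n
    ... | z , qᵐ≡ | w , qⁿ≡ = ∣m+n∣m⇒∣n (subst (r ∣_) eq′ (m∣m*n z)) (∣n⇒∣m*n q (m∣m*n w))
      where
      open ≡-Reasoning
      distr : ∀ u v → suc u * suc v ≡ suc (suc u * v + u)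
      distr = solve-∀
      eq′ : r * z ≡ q * (r * w) + q-1
      eq′ = suc-injective (begin
        suc (r * z)        ≡⟨ qᵐ≡ ⟨
        q ^ (x * m)        ≡⟨ cong (q ^_) eq ⟨
        q * q ^ (y * n)    ≡⟨ cong (q *_) qⁿ≡ ⟩
        q * suc (r * w)    ≡⟨ distr q-1 (r * w) ⟩
        suc (q * (r * w) + q-1) ∎)

    fromBézout : Bézout.Identity 1 m n → r ∣ q-1
    fromBézout (Bézout.+- x y eq) = lemma x y m n eq r∣m r∣n
    fromBézout (Bézout.-+ x y eq) = lemma y x n m eq r∣n r∣m

  %-≡⇒∣∸ : ∀ m n {r} .{{_ : NonZero r}} → m % r ≡ n % r → r ∣ m ∸ n
  %-≡⇒∣∸ m n {r} eq = subst (r ∣_) (sym (begin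
      m ∸ n                                       ≡⟨ cong₂ _∸_ (m≡m%n+[m/n]*n m r) (m≡m%n+[m/n]*n n r) ⟩
      (m % r + m / r * r) ∸ (n % r + n / r * r)   ≡⟨ cong (λ x → (x + m / r * r) ∸ (n % r + n / r * r)) eq ⟩
      (n % r + m / r * r) ∸ (n % r + n / r * r)   ≡⟨ [m+n]∸[m+o]≡n∸o (n % r) (m / r * r) (n / r * r) ⟩
      m / r * r ∸ n / r * r                       ≡⟨ *-distribʳ-∸ r (m / r) (n / r) ⟨
      (m / r ∸ n / r) * r ∎)) (n∣m*n (m / r ∸ n / r))
    where open ≡-Reasoning

  ∣^-1⇒∤ : ∀ {r} q n → .{{NonZero q}} → Prime r → .{{NonZero n}} → r ∣ q ^ n ∸ 1 → r ∤ q
  ∣^-1⇒∤ {r} q n@(suc n-1) r-prime r∣ r∣q with ∸1-∣⇒≡suc {{m^n≢0 q n}} r∣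
  ... | x , eq = prime≢1 r-prime (∣1⇒≡1 (∣m+n∣m⇒∣n
    (subst (r ∣_) (trans eq (+-comm 1 (r * x))) (∣m⇒∣m*n (q ^ n-1) r∣q)) (m∣m*n x)))

  -- By pigeonhole some power of q with exponent n between 1 and r - 1 is 1
  -- modulo r, and n is coprime to rʰ.
  ∣^rʰ-1⇒∣-1 : ∀ {r} q h → .{{NonZero q}} → Prime r → r ∣ q ^ (r ^ h) ∸ 1 → r ∣ q ∸ 1
  ∣^rʰ-1⇒∣-1 {zero} q h r-prime r∣ = contradiction r-prime ¬prime[0]
  ∣^rʰ-1⇒∣-1 {r@(suc r-1)} q h r-prime r∣ = repeat⇒∣-1 (pigeonhole (n<1+n r-1) residue)
    where
    open ≡-Reasoning
    r∤qⁿ : ∀ n → r ∤ q ^ n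
    r∤qⁿ n = ∣^-1⇒∤ q (r ^ h) r-prime {{m^n≢0 r h}} r∣ ∘ prime∣^⇒∣ n r-prime
    qⁿ%r≢0 : ∀ n → NonZero (q ^ n % r)
    qⁿ%r≢0 n = ≢-nonZero (r∤qⁿ n ∘ m%n≡0⇒n∣m (q ^ n) r)
    suc-pred-% : ∀ n → suc (pred (q ^ n % r)) ≡ q ^ n % r
    suc-pred-% n = suc-pred (q ^ n % r) {{qⁿ%r≢0 n}}
    residue< : ∀ n → pred (q ^ n % r) < r-1
    residue< n = ≤-pred (subst (_< r) (sym (suc-pred-% n)) (m%n<n (q ^ n) r))
    -- No power of q is 0 modulo r, so the r powers with exponents 0, ..., r - 1 share r - 1
    -- residues; `pred` numbers these from 0.
    residue : Fin r → Fin r-1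
    residue i = fromℕ< (residue< (toℕ i))
    repeat⇒∣-1 : (∃[ i ] ∃[ j ] i Fin.< j × residue i ≡ residue j) → r ∣ q ∸ 1
    repeat⇒∣-1 (i , j , i<j , eq) = ∣^-1∧coprime⇒∣-1 q n (r ^ h)
        (Coprimality.sym (coprime-^ˡ h (∤⇒coprime r-prime λ r∣n →
          <⇒≱ (≤-<-trans (m∸n≤m (toℕ j) (toℕ i)) (toℕ<n j)) (∣⇒≤ {{>-nonZero (m<n⇒0<n∸m i<j)}} r∣n))))
        r∣qⁿ-1 r∣
      where
      n = toℕ j ∸ toℕ i
      same-residue : q ^ toℕ j % r ≡ q ^ toℕ i % r
      same-residue = begin
        q ^ toℕ j % r                 ≡⟨ suc-pred-% (toℕ j) ⟨
        suc (pred (q ^ toℕ j % r))    ≡⟨ cong suc (toℕ-fromℕ< (residue< (toℕ j))) ⟨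
        suc (toℕ (residue j))         ≡⟨ cong (suc ∘ toℕ) eq ⟨
        suc (toℕ (residue i))         ≡⟨ cong suc (toℕ-fromℕ< (residue< (toℕ i))) ⟩
        suc (pred (q ^ toℕ i % r))    ≡⟨ suc-pred-% (toℕ i) ⟩
        q ^ toℕ i % r ∎
      factor : q ^ toℕ j ∸ q ^ toℕ i ≡ q ^ toℕ i * (q ^ n ∸ 1)
      factor = begin
        q ^ toℕ j ∸ q ^ toℕ i               ≡⟨ cong (λ m → q ^ m ∸ q ^ toℕ i) (m+[n∸m]≡n (<⇒≤ i<j)) ⟨
        q ^ (toℕ i + n) ∸ q ^ toℕ i
          ≡⟨ cong₂ _∸_ (^-distribˡ-+-* q (toℕ i) n) (sym (*-identityʳ (q ^ toℕ i))) ⟩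
        q ^ toℕ i * q ^ n ∸ q ^ toℕ i * 1   ≡⟨ *-distribˡ-∸ (q ^ toℕ i) (q ^ n) 1 ⟨
        q ^ toℕ i * (q ^ n ∸ 1) ∎
      r∣qⁿ-1 : r ∣ q ^ n ∸ 1
      r∣qⁿ-1 = [ ⊥-elim ∘ r∤qⁿ (toℕ i) , (λ r∣ → r∣) ]′ (euclidsLemma (q ^ toℕ i) (q ^ n ∸ 1) r-prime
        (subst (r ∣_) factor (%-≡⇒∣∸ (q ^ toℕ j) (q ^ toℕ i) same-residue)))

  -- Geometric sums of ratio q and divisibility by b.

  module _
    (q : ℕ) .{{_ : NonZero q}}
    {s} (t : ℕ) (r e : Vector ℕ s)
    (r-prime : ∀ i → Prime (r i))
    (r≢2 : ∀ i → r i ≢ 2)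
    (r-injective : Injective _≡_ _≡_ r)
    (e≥1 : ∀ i → 1 ≤ e i)
    (order-rʰ : ∀ i → ∃[ h ] (h ≤ e i ∸ 1 × IsMultiplicativeOrder q (r i ^ e i) (r i ^ h)))
    (2-condition : (t ≡ 0 ⊎ t ≡ 1) ⊎ (2 ≤ t × q ≡ 1 [mod 4 ]))
    (odd : 1 ≤ t → 2 ∤ q)
    where

    private
      b′ = primePowers r e
      b  = 2 ^ t * b′

      r∣q-1 : ∀ i → r i ∣ q ∸ 1
      r∣q-1 i with order-rʰ i
      ... | h , _ , (_ , q^rʰ≡1) , _ = ∣^rʰ-1⇒∣-1 q h (r-prime i)
          (∣-trans (r∣rᵉ (e i) (e≥1 i))
            (subst (r i ^ e i ∣_) (cong (_∸ 1) (sym q^rʰ≡)) (m∣m*n {r i ^ e i} x)))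
        where
        x = proj₁ (≡1[mod]⇒≡suc {{m^n≢0 q (r i ^ h)}} q^rʰ≡1)
        q^rʰ≡ : q ^ (r i ^ h) ≡ suc (r i ^ e i * x)
        q^rʰ≡ = proj₂ (≡1[mod]⇒≡suc {{m^n≢0 q (r i ^ h)}} q^rʰ≡1)
        r∣rᵉ : ∀ n → 1 ≤ n → r i ∣ r i ^ n
        r∣rᵉ (suc n) _ = m∣m*n (r i ^ n)

      lifts : ∀ i → Lifts (r i) q
      lifts i = inj₁ (r≢2 i , ∸1-∣⇒≡suc (r∣q-1 i))

      odd⇒≡ : 2 ∤ q → ∃[ x ] q ≡ suc (2 * x)
      odd⇒≡ 2∤q with q % 2 in eq | m%n<n q 2
      ... | 0 | _ = contradiction (m%n≡0⇒n∣m q 2 eq) 2∤q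
      ... | 1 | _ = q / 2 , trans (m≡m%n+[m/n]*n q 2) (cong₂ _+_ eq (*-comm (q / 2) 2))
      ... | suc (suc _) | s≤s (s≤s ())

      -- For t = 1 it is enough that all terms are odd. For t ≥ 2 oddness would not do: 4 divides 1
      -- + 3 although there are only two terms.
      2ᵗ∣geometricSum⇒2ᵗ∣ : ∀ u → 2 ^ t ∣ geometricSum q u → 2 ^ t ∣ u
      2ᵗ∣geometricSum⇒2ᵗ∣ u = case 2-condition of λ where
        (inj₁ (inj₁ refl)) _ → 1∣ u
        (inj₁ (inj₂ refl)) → ∣geometricSum⇒∣ u (odd⇒≡ (odd ≤-refl))
        (inj₂ (_ , q≡1)) → ^∣geometricSum⇒^∣ t u prime[2] (inj₂ (refl , ≡1[mod]⇒≡suc q≡1))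

      2ᵗ∣geometricSum : 2 ^ t ∣ geometricSum q (2 ^ t)
      2ᵗ∣geometricSum = case t ℕ.≟ 0 of λ where
        (yes refl) → 1∣ _
        (no t≢0)   → ^∣geometricSum t (odd⇒≡ (odd (n≢0⇒n>0 t≢0)))

      2⊥b′ : Coprime (2 ^ t) b′
      2⊥b′ = Coprimality.sym (primePowers-coprime r e (λ i → Coprimality.sym (coprime-^ˡ t
        (∤⇒coprime prime[2] (λ 2∣r → r≢2 i (sym (prime∣prime prime[2] (r-prime i) 2∣r)))))))

    ∣geometricSum⇒∣ᵇ : ∀ u → b ∣ geometricSum q u → b ∣ u
    ∣geometricSum⇒∣ᵇ u b∣ = coprime-*-∣ 2⊥b′
      (2ᵗ∣geometricSum⇒2ᵗ∣ u (m*n∣⇒m∣ (2 ^ t) b′ b∣))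
      (primePowers-∣ r e r-prime r-injective (λ i →
        ^∣geometricSum⇒^∣ (e i) u (r-prime i) (lifts i)
          (∣-trans (^∣primePowers r e i) (m*n∣⇒n∣ (2 ^ t) b′ b∣))))

    -- Together with c ∣ q - 1 this yields b c ∣ qᵇ - 1, so that k′ is an exact quotient.
    ∣geometricSumᵇ : b ∣ geometricSum q b
    ∣geometricSumᵇ = coprime-*-∣ 2⊥b′
      (∣-trans 2ᵗ∣geometricSum (geometricSum-monoʳ-∣ q (m∣m*n {2 ^ t} b′)))
      (primePowers-∣ r e r-prime r-injective (λ i →
        ∣-trans (^∣geometricSum (e i) (∸1-∣⇒≡suc (r∣q-1 i)))
          (geometricSum-monoʳ-∣ q (∣n⇒∣m*n (2 ^ t) (^∣primePowers r e i)))))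

open NumberTheory

-- Injections of finite sets and sums over them.

-- A missed y could be punched out of the codomain, leaving an injection into a set with fewer than
-- m elements.
injective⇒surjective : ∀ {m n} (f : Fin m → Fin n) → Injective _≡_ _≡_ f → n ≤ m →
                       ∀ y → ∃[ x ] f x ≡ y
injective⇒surjective {m} {suc n} f f-inj n<m y with any? (λ x → f x ≟ y)
... | yes hit = hit
... | no  miss = contradiction n<m (ℕ.≤⇒≯ (injective⇒≤ {f = λ x → punchOut (avoids x)}
                   (λ {x} {x′} → f-inj ∘ punchOut-injective (avoids x) (avoids x′))))
  where
  avoids : ∀ x → y ≢ f x
  avoids x y≡fx = miss (x , sym y≡fx)

injective⇒permutation : ∀ {n} (f : Fin n → Fin n) → Injective _≡_ _≡_ f → Permutation′ n
injective⇒permutation f f-inj = permutation f f⁻¹ f∘f⁻¹ (λ x → f-inj (f∘f⁻¹ (f x)))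
  where
  f⁻¹ = proj₁ ∘ injective⇒surjective f f-inj ℕ.≤-refl
  f∘f⁻¹ = proj₂ ∘ injective⇒surjective f f-inj ℕ.≤-refl

distinct⇒1<n : ∀ {n} {x y : Fin n} → x ≢ y → 1 < n
distinct⇒1<n {suc (suc n)} x≢y = s≤s (s≤s z≤n)
distinct⇒1<n {suc zero} {zero} {zero} x≢y = contradiction refl x≢y

enumerateOthers : ∀ {n} (z : Fin n) →
                  Σ[ f ∈ (Fin (n ∸ 1) → Fin n) ] Injective _≡_ _≡_ f × (∀ i → f i ≢ z)
enumerateOthers {suc n} z = punchIn z , punchIn-injective z _ _ , punchInᵢ≢i z

module _ {c ℓ} (M : CommutativeMonoid c ℓ) where
  open CommutativeMonoid M
  open MonoidSum M using (sum; sum-cong-≋; sum-replicate; ∑-distrib-+; sum-permute)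
  open MonoidMult monoid using () renaming (_×_ to _·_)
  open import Relation.Binary.Reasoning.Setoid setoid

  -- Reindexing by σ permutes the terms and at the same time adds x to each of them. Read additively
  -- this gives q · x = 0 in a field of q elements, read multiplicatively xⁿ = 1.
  sum-translate : ∀ {n} x (f : Fin n → Carrier) (σ : Fin n → Fin n) → Injective _≡_ _≡_ σ →
                  (∀ i → f (σ i) ≈ x ∙ f i) → sum f ≈ n · x ∙ sum f
  sum-translate {n} x f σ σ-inj f∘σ≈x∙f = begin
    sum f                    ≈⟨ sum-permute f (injective⇒permutation σ σ-inj) ⟩
    sum (f ∘ σ)              ≈⟨ sum-cong-≋ f∘σ≈x∙f ⟩
    sum (λ i → x ∙ f i)      ≈⟨ ∑-distrib-+ {n} (λ _ → x) f ⟩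
    sum (λ (_ : Fin n) → x) ∙ sum f  ≈⟨ ∙-congʳ (sum-replicate n) ⟩
    n · x ∙ sum f            ∎

-- Finite fields: counting, roots, cyclicity of the unit group.

record FieldOn (q : ℕ) : Set where
  infix  8 -_
  infixl 7 _*_
  infixl 6 _+_
  field
    _+_ _*_ : Fin q → Fin q → Fin q
    -_      : Fin q → Fin q
    0# 1#   : Fin q
    isCommutativeRing : IsCommutativeRing _≡_ _+_ _*_ -_ 0# 1#
    1≢0     : 1# ≢ 0#
    inverse : ∀ x → x ≢ 0# → ∃[ y ] x * y ≡ 1#

  commutativeRing : CommutativeRing 0ℓ 0ℓ
  commutativeRing = record { isCommutativeRing = isCommutativeRing }

  open CommutativeRing commutativeRing public
    using (+-assoc; +-comm; +-identityˡ; +-identityʳ; -‿inverseˡ; -‿inverseʳ;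
           *-assoc; *-comm; *-identityˡ; *-identityʳ; zeroˡ; zeroʳ; distribˡ; distribʳ;
           ring; semiring; commutativeSemiring; +-commutativeMonoid; *-commutativeMonoid)
  open Exp commutativeSemiring public
  open Mult semiring public renaming (_×_ to infixr 8 _·_)

module FieldProperties {q} (K : FieldOn q) where
  open FieldOn K
  open RingProperties ring using (+-cancelˡ; +-cancelʳ)
  open SemiringSolver commutativeSemiring using (solve; _:+_; _:*_; _:=_; con)
  open ≡.≡-Reasoning

  *-nonzero-cancelˡ : ∀ x {y z} → x ≢ 0# → x * y ≡ x * z → y ≡ z
  *-nonzero-cancelˡ x {y} {z} x≢0 xy≡xz = begin
    y             ≡⟨ unfold y ⟩
    x⁻¹ * (x * y) ≡⟨ cong (x⁻¹ *_) xy≡xz ⟩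
    x⁻¹ * (x * z) ≡⟨ unfold z ⟨
    z ∎
    where
    x⁻¹ = proj₁ (inverse x x≢0)
    unfold : ∀ y → y ≡ x⁻¹ * (x * y)
    unfold y = begin
      y             ≡⟨ *-identityˡ y ⟨
      1# * y        ≡⟨ cong (_* y) (proj₂ (inverse x x≢0)) ⟨
      x * x⁻¹ * y   ≡⟨ cong (_* y) (*-comm x x⁻¹) ⟩
      x⁻¹ * x * y   ≡⟨ *-assoc x⁻¹ x y ⟩
      x⁻¹ * (x * y) ∎

  *-nonzero : ∀ {x y} → x ≢ 0# → y ≢ 0# → x * y ≢ 0#
  *-nonzero {x} x≢0 y≢0 xy≡0 = y≢0 (*-nonzero-cancelˡ x x≢0 (trans xy≡0 (sym (zeroʳ x))))

  ^-nonzero : ∀ {x} n → x ≢ 0# → x ^ n ≢ 0#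
  ^-nonzero zero    x≢0 = 1≢0
  ^-nonzero (suc n) x≢0 = *-nonzero x≢0 (^-nonzero n x≢0)

  *-distinct : ∀ {x y z} → x ≢ y → x * z ≡ y * z → z ≡ 0#
  *-distinct {x} {y} {z} x≢y xz≡yz = decidable-stable (z ≟ 0#) λ z≢0 →
    x≢y (*-nonzero-cancelˡ z z≢0 (trans (*-comm z x) (trans xz≡yz (*-comm y z))))

  1^n≡1 : ∀ n → 1# ^ n ≡ 1#
  1^n≡1 zero    = refl
  1^n≡1 (suc n) = trans (*-identityˡ _) (1^n≡1 n)

  0^n≡0 : ∀ n → .{{NonZero n}} → 0# ^ n ≡ 0#
  0^n≡0 (suc n) = zeroˡ _

  ^-swap : ∀ x m n → (x ^ m) ^ n ≡ (x ^ n) ^ m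
  ^-swap x m n = trans (^-assocʳ x m n) (trans (cong (x ^_) (ℕ.*-comm m n)) (sym (^-assocʳ x n m)))

  ^-∣-≡1 : ∀ {x m n} → m ∣ n → x ^ m ≡ 1# → x ^ n ≡ 1#
  ^-∣-≡1 {x} {m} (divides k refl) xᵐ≡1 = begin
    x ^ (k ℕ.* m)  ≡⟨ cong (x ^_) (ℕ.*-comm k m) ⟩
    x ^ (m ℕ.* k)  ≡⟨ ^-assocʳ x m k ⟨
    (x ^ m) ^ k    ≡⟨ cong (_^ k) xᵐ≡1 ⟩
    1# ^ k         ≡⟨ 1^n≡1 k ⟩
    1# ∎

  -- Counting

  -- Multiplication by x permutes the listed elements, and their product is nonzero and cancels.
  *-translate : ∀ {n} (f : Fin n → Fin q) → Injective _≡_ _≡_ f → (∀ i → f i ≢ 0#) →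
                ∀ {x} → x ≢ 0# → (∀ i → ∃[ j ] f j ≡ x * f i) → x ^ n ≡ 1#
  *-translate {n} f f-inj f≢0 {x} x≢0 closed = sym (*-nonzero-cancelˡ ∏ ∏≢0 (begin
      ∏ * 1#      ≡⟨ *-identityʳ ∏ ⟩
      ∏           ≡⟨ sum-translate *-commutativeMonoid x f (proj₁ ∘ closed) σ-inj (proj₂ ∘ closed) ⟩
      x ^ n * ∏   ≡⟨ *-comm (x ^ n) ∏ ⟩
      ∏ * x ^ n   ∎))
    where
    open MonoidSum *-commutativeMonoid using (sum)
    ∏ = sum f
    product≢0 : ∀ {n} (f : Fin n → Fin q) → (∀ i → f i ≢ 0#) → sum f ≢ 0#
    product≢0 {zero}  f f≢0 = 1≢0
    product≢0 {suc n} f f≢0 = *-nonzero (f≢0 zero) (product≢0 (f ∘ suc) (f≢0 ∘ suc))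
    ∏≢0 : ∏ ≢ 0#
    ∏≢0 = product≢0 f f≢0
    σ-inj : Injective _≡_ _≡_ (proj₁ ∘ closed)
    σ-inj {i} {j} σi≡σj = f-inj (*-nonzero-cancelˡ x x≢0 (begin
      x * f i            ≡⟨ proj₂ (closed i) ⟨
      f (proj₁ (closed i)) ≡⟨ cong f σi≡σj ⟩
      f (proj₁ (closed j)) ≡⟨ proj₂ (closed j) ⟩
      x * f j ∎))

  -- Meant for spans, which contain 0: that index is punched out, and multiplication by x keeps the
  -- remaining elements away from it.
  lagrange : ∀ {n} (f : Fin n → Fin q) → Injective _≡_ _≡_ f → ∃[ i ] f i ≡ 0# →
             ∀ {x} → x ≢ 0# → (∀ i → ∃[ j ] f j ≡ x * f i) → x ^ (n ∸ 1) ≡ 1#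
  lagrange {suc n} f f-inj (i₀ , fi₀≡0) {x} x≢0 closed =
    *-translate (f ∘ punchIn i₀) (punchIn-injective i₀ _ _ ∘ f-inj) f≢0 x≢0 closed′
    where
    f≢0 : ∀ i → f (punchIn i₀ i) ≢ 0#
    f≢0 i eq = punchInᵢ≢i i₀ i (f-inj (trans eq (sym fi₀≡0)))
    closed′ : ∀ i → ∃[ j ] f (punchIn i₀ j) ≡ x * f (punchIn i₀ i)
    closed′ i with closed (punchIn i₀ i)
    ... | j , fj≡ = punchOut i₀≢j , trans (cong f (punchIn-punchOut i₀≢j)) fj≡
      where
      i₀≢j : i₀ ≢ j
      i₀≢j refl = *-nonzero x≢0 (f≢0 i) (trans (sym fj≡) fi₀≡0)

  x^[q-1]≡1 : ∀ {x} → x ≢ 0# → x ^ (q ∸ 1) ≡ 1#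
  x^[q-1]≡1 x≢0 = lagrange (λ i → i) (λ eq → eq) (0# , refl) x≢0 (λ i → _ , refl)

  q·x≡0 : ∀ x → q · x ≡ 0#
  q·x≡0 x = sym (+-cancelʳ (sum (λ i → i)) 0# (q · x) (trans (+-identityˡ _)
    (sum-translate +-commutativeMonoid x (λ i → i) (x +_) (+-cancelˡ x _ _) (λ _ → refl))))
    where open MonoidSum +-commutativeMonoid using (sum)

  -- Roots of monic polynomials

  -- The value at x of the monic polynomial whose other coefficients are
  -- listed from the constant one upwards.
  monic : List (Fin q) → Fin q → Fin q
  monic []       x = 1#
  monic (a ∷ as) x = a + x * monic as x

  -- Synthetic division by X - y.
  quotient : Fin q → List (Fin q) → List (Fin q)
  quotient y []           = []
  quotient y (a ∷ [])     = []
  quotient y (a ∷ b ∷ as) = monic (b ∷ as) y ∷ quotient y (b ∷ as)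

  length-quotient : ∀ y a as → length (quotient y (a ∷ as)) ≡ length as
  length-quotient y a []       = refl
  length-quotient y a (b ∷ as) = cong suc (length-quotient y b as)

  -- as(x) - as(y) = (x - y) quotient(x), without subtraction.
  monic-quotient : ∀ x y a as → let p = a ∷ as in
    monic p x + y * monic (quotient y p) x ≡ x * monic (quotient y p) x + monic p y
  monic-quotient x y a [] =
    solve 4 (λ a x y z → (a :+ x :* z) :+ y :* z := x :* z :+ (a :+ y :* z)) refl a x y 1#
  monic-quotient x y a (b ∷ as) = begin
    a + x * f x + y * (f y + x * g)        ≡⟨ solve 6 (λ a x y u v w →
       (a :+ x :* u) :+ y :* (v :+ x :* w) := (a :+ y :* v) :+ x :* (u :+ y :* w)) refl a x y (f x) (f y) g ⟩
    a + y * f y + x * (f x + y * g)        ≡⟨ cong (λ z → a + y * f y + x * z) (monic-quotient x y b as) ⟩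
    a + y * f y + x * (x * g + f y)        ≡⟨ solve 5 (λ a x y v w →
       (a :+ y :* v) :+ x :* (x :* w :+ v) := x :* (v :+ x :* w) :+ (a :+ y :* v)) refl a x y (f y) g ⟩
    x * (f y + x * g) + (a + y * f y) ∎
    where
    f = monic (b ∷ as)
    g = monic (quotient y (b ∷ as)) x

  root-bound : ∀ {n} as (ρ : Fin n → Fin q) → Injective _≡_ _≡_ ρ →
               (∀ i → monic as (ρ i) ≡ 0#) → n ≤ length as
  root-bound {zero}  as ρ ρ-inj root = z≤n
  root-bound {suc n} [] ρ ρ-inj root = contradiction (root zero) 1≢0
  root-bound {suc n} p@(a ∷ as) ρ ρ-inj root =
    s≤s (subst (n ≤_) (length-quotient y a as)
      (root-bound (quotient y p) (ρ ∘ suc) (Fin.suc-injective ∘ ρ-inj) root′))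
    where
    y = ρ zero
    root′ : ∀ i → monic (quotient y p) (ρ (suc i)) ≡ 0#
    root′ i = *-distinct (λ y≡x → case ρ-inj y≡x of λ ()) (begin
      y * g                 ≡⟨ +-identityˡ _ ⟨
      0# + y * g            ≡⟨ cong (_+ y * g) (root (suc i)) ⟨
      monic p x + y * g     ≡⟨ monic-quotient x y a as ⟩
      x * g + monic p y     ≡⟨ cong (x * g +_) (root zero) ⟩
      x * g + 0#            ≡⟨ +-identityʳ _ ⟩
      x * g ∎)
      where
      x = ρ (suc i)
      g = monic (quotient y p) x

  unity-bound : ∀ {m n} → .{{NonZero n}} → (ρ : Fin m → Fin q) → Injective _≡_ _≡_ ρ →
                (∀ i → ρ i ^ n ≡ 1#) → m ≤ n
  unity-bound {m} {suc n} ρ ρ-inj root = subst (m ≤_) (cong suc (length-replicate n))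
    (root-bound (- 1# ∷ List.replicate n 0#) ρ ρ-inj λ i → begin
      - 1# + ρ i * monic (List.replicate n 0#) (ρ i)  ≡⟨ cong (λ x → - 1# + ρ i * x) (monic-0 n) ⟩
      - 1# + ρ i ^ suc n                         ≡⟨ cong (- 1# +_) (root i) ⟩
      - 1# + 1#                                  ≡⟨ -‿inverseˡ 1# ⟩
      0# ∎)
    where
    monic-0 : ∀ n {x} → monic (List.replicate n 0#) x ≡ x ^ n
    monic-0 zero    = refl
    monic-0 (suc n) {x} = trans (+-identityˡ _) (cong (x *_) (monic-0 n))

  -- Orders of elements

  HasOrder : Fin q → ℕ → Set
  HasOrder x n = x ^ n ≡ 1# × (∀ j → x ^ j ≡ 1# → n ∣ j)

  hasOrder⇒≢0 : ∀ {x} n → .{{NonZero n}} → HasOrder x n → x ≢ 0#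
  hasOrder⇒≢0 n (xⁿ≡1 , _) refl = 1≢0 (trans (sym xⁿ≡1) (0^n≡0 n))

  hasOrder-^ : ∀ {x} m {n} → .{{NonZero m}} → HasOrder x (m ℕ.* n) → HasOrder (x ^ m) n
  hasOrder-^ {x} m {n} (xᵐⁿ≡1 , minimal) =
    trans (^-assocʳ x m n) xᵐⁿ≡1 ,
    λ j eq → *-cancelˡ-∣ m (minimal (m ℕ.* j) (trans (sym (^-assocʳ x m j)) eq))

  -- Raising (x y) ^ j = 1 to the n-th power removes y and leaves x ^ (j n) = 1, so m ∣ j as m is
  -- prime to n; the other factor is symmetric.
  hasOrder-* : ∀ {x y m n} → Coprime m n → HasOrder x m → HasOrder y n → HasOrder (x * y) (m ℕ.* n)
  hasOrder-* {x} {y} {m} {n} m⊥n (xᵐ≡1 , x-min) (yⁿ≡1 , y-min) =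
    [xy]^≡ (m ℕ.* n) (^-∣-≡1 (m∣m*n {m} n) xᵐ≡1) (^-∣-≡1 (n∣m*n m) yⁿ≡1) ,
    λ j eq → coprime-*-∣ m⊥n
      (coprime-divisor m⊥n (subst (m ∣_) (ℕ.*-comm j n) (x-min (j ℕ.* n)
        (separate j n eq (*-comm (x ^ (j ℕ.* n)) _) (^-∣-≡1 (n∣m*n j) yⁿ≡1)))))
      (coprime-divisor (Coprimality.sym m⊥n) (subst (n ∣_) (ℕ.*-comm j m) (y-min (j ℕ.* m)
        (separate j m eq refl (^-∣-≡1 (n∣m*n j) xᵐ≡1)))))
    where
    [xy]^≡ : ∀ j → x ^ j ≡ 1# → y ^ j ≡ 1# → (x * y) ^ j ≡ 1#
    [xy]^≡ j xʲ≡1 yʲ≡1 = trans (^-distrib-* x y j) (trans (cong₂ _*_ xʲ≡1 yʲ≡1) (*-identityˡ 1#))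
    separate : ∀ j k {u v} → (x * y) ^ j ≡ 1# → x ^ (j ℕ.* k) * y ^ (j ℕ.* k) ≡ u * v → u ≡ 1# → v ≡ 1#
    separate j k {u} {v} eq split u≡1 = begin
      v                              ≡⟨ *-identityˡ v ⟨
      1# * v                         ≡⟨ cong (_* v) u≡1 ⟨
      u * v                          ≡⟨ split ⟨
      x ^ (j ℕ.* k) * y ^ (j ℕ.* k)  ≡⟨ ^-distrib-* x y (j ℕ.* k) ⟨
      (x * y) ^ (j ℕ.* k)            ≡⟨ ^-∣-≡1 (m∣m*n {j} k) eq ⟩
      1# ∎

  coprime-^≡1 : ∀ {x m n} → Coprime m n → x ^ m ≡ 1# → x ^ n ≡ 1# → x ≡ 1#
  coprime-^≡1 {x} m⊥n xᵐ≡1 xⁿ≡1 = case coprime-Bézout m⊥n of λ where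
      (Bézout.+- k l eq) → bézout k l eq xᵐ≡1 xⁿ≡1
      (Bézout.-+ k l eq) → bézout l k eq xⁿ≡1 xᵐ≡1
    where
    bézout : ∀ k l {m n} → suc (l ℕ.* n) ≡ k ℕ.* m → x ^ m ≡ 1# → x ^ n ≡ 1# → x ≡ 1#
    bézout k l {m} {n} eq xᵐ≡1 xⁿ≡1 = begin
      x                   ≡⟨ *-identityʳ x ⟨
      x * 1#              ≡⟨ cong (x *_) (^-∣-≡1 (n∣m*n l) xⁿ≡1) ⟨
      x ^ suc (l ℕ.* n)   ≡⟨ cong (x ^_) eq ⟩
      x ^ (k ℕ.* m)       ≡⟨ ^-∣-≡1 (n∣m*n k) xᵐ≡1 ⟩
      1# ∎

  -- If y ^ j = 1 with j = r ^ f m, r ∤ m and f ≤ e, then z = y ^ (r ^ e) satisfies z ^ r = 1 and z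
  -- ^ m = 1, hence z = 1.
  hasOrder-primePower : ∀ {r y} e → Prime r → y ^ (r ℕ.^ suc e) ≡ 1# → y ^ (r ℕ.^ e) ≢ 1# →
                        HasOrder y (r ℕ.^ suc e)
  hasOrder-primePower {r} {y} e r-prime y^≡1 y^≢1 = y^≡1 , minimal
    where
    ^-monoʳ-∣ : ∀ {m n} → m ≤ n → r ℕ.^ m ∣ r ℕ.^ n
    ^-monoʳ-∣ {m} m≤n with ℕ.m≤n⇒∃[o]m+o≡n m≤n
    ... | o , refl = subst (r ℕ.^ m ∣_) (sym (ℕ.^-distribˡ-+-* r m o)) (m∣m*n (r ℕ.^ o))
    minimal : ∀ j → y ^ j ≡ 1# → r ℕ.^ suc e ∣ j
    minimal zero    yʲ≡1 = _ ∣0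
    minimal j@(suc _) yʲ≡1 with maximal-power r-prime j
    ... | f , m , j≡ , r∤m with f ℕ.≤? e
    ...   | no f≰e = subst (r ℕ.^ suc e ∣_) (sym j≡) (∣-trans (^-monoʳ-∣ (ℕ.≰⇒> f≰e)) (m∣m*n m))
    ...   | yes f≤e = contradiction (coprime-^≡1 (∤⇒coprime r-prime r∤m) zʳ≡1 zᵐ≡1) y^≢1
      where
      zʳ≡1 : (y ^ (r ℕ.^ e)) ^ r ≡ 1#
      zʳ≡1 = trans (^-assocʳ y (r ℕ.^ e) r) (trans (cong (y ^_) (ℕ.*-comm (r ℕ.^ e) r)) y^≡1)
      zᵐ≡1 : (y ^ (r ℕ.^ e)) ^ m ≡ 1#
      zᵐ≡1 = trans (^-assocʳ y (r ℕ.^ e) m) (^-∣-≡1 (subst (_∣ r ℕ.^ e ℕ.* m) (sym j≡)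
        (*-monoˡ-∣ m (^-monoʳ-∣ f≤e))) yʲ≡1)

  instance
    q-1≢0 : NonZero (q ∸ 1)
    q-1≢0 = ℕ.>-nonZero (ℕ.m<n⇒0<n∸m (distinct⇒1<n 1≢0))

  ∃^≢1 : ∀ n → .{{NonZero n}} → n < q ∸ 1 → ∃[ x ] x ≢ 0# × x ^ n ≢ 1#
  ∃^≢1 n n<q-1 with any? (λ x → ¬? (x ≟ 0#) ×-dec ¬? (x ^ n ≟ 1#))
  ... | yes found = found
  ... | no  none  =
    let f , f-inj , f≢0 = enumerateOthers 0#
    in  contradiction n<q-1 (ℕ.≤⇒≯ (unity-bound f f-inj λ i →
          decidable-stable (f i ^ n ≟ 1#) λ fiⁿ≢1 → none (f i , f≢0 i , fiⁿ≢1)))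

  ∃hasOrder-primePower : ∀ {r} e → Prime r → r ℕ.^ e ∣ q ∸ 1 → ∃[ y ] HasOrder y (r ℕ.^ e)
  ∃hasOrder-primePower zero r-prime r∣ = 1# , 1^n≡1 1 , λ j _ → 1∣ j
  ∃hasOrder-primePower {r} (suc e) r-prime (divides m q-1≡) = y ,
    hasOrder-primePower e r-prime
      (trans (^-assocʳ x m (r ℕ.^ suc e)) (trans (cong (x ^_) (sym q-1≡)) (x^[q-1]≡1 x≢0)))
      (λ eq → xᴹ≢1 (trans (sym (^-assocʳ x m (r ℕ.^ e))) eq))
    where
    -- M is (q - 1) / r, small enough for some x to have x ^ M ≢ 1; with y = x ^ m, that power is y
    -- ^ (r ^ e).
    M = m ℕ.* r ℕ.^ e
    M*r≡ : M ℕ.* r ≡ q ∸ 1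
    M*r≡ = trans (ℕ.*-assoc m (r ℕ.^ e) r) (trans (cong (m ℕ.*_) (ℕ.*-comm (r ℕ.^ e) r)) (sym q-1≡))
    instance
      _ = prime⇒nonTrivial r-prime
      M≢0 : NonZero M
      M≢0 = ℕ.m*n≢0⇒m≢0 M {r} {{subst NonZero (sym M*r≡) q-1≢0}}
    nonunity = ∃^≢1 M (subst (M <_) M*r≡ (ℕ.m<m*n M r (ℕ.nonTrivial⇒n>1 r)))
    x = proj₁ nonunity
    x≢0 = proj₁ (proj₂ nonunity)
    xᴹ≢1 = proj₂ (proj₂ nonunity)
    y = x ^ m

  -- At n = q - 1 this is cyclicity of the unit group. The full power of one prime is split off n,
  -- and coprime orders multiply.
  ∃hasOrder : ∀ n → n ∣ q ∸ 1 → ∃[ x ] HasOrder x n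
  ∃hasOrder = <-rec (λ n → n ∣ q ∸ 1 → ∃[ x ] HasOrder x n) step
    where
    step : ∀ n → (∀ {m} → m < n → m ∣ q ∸ 1 → ∃[ x ] HasOrder x m) → n ∣ q ∸ 1 → ∃[ x ] HasOrder x n
    step zero rec n∣ = contradiction (0∣⇒≡0 n∣) (ℕ.≢-nonZero⁻¹ (q ∸ 1))
    step n@(suc _) rec n∣ with factorise n
    ... | record { factors = [] ; isFactorisation = n≡1 } =
      1# , 1^n≡1 n , λ j _ → subst (_∣ j) (sym n≡1) (1∣ j)
    ... | record { factors = r ∷ rs ; isFactorisation = n≡ ; factorsPrime = r-prime ∷ _ }
      with maximal-power r-prime n
    ...   | zero , m , n≡m , r∤m =
      contradiction (subst (r ∣_) (trans (sym n≡) (trans n≡m (ℕ.*-identityˡ m))) (m∣m*n _)) r∤m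
    ...   | suc e , m , n≡rᵉm , r∤m =
      let y , y-order = ∃hasOrder-primePower (suc e) r-prime (∣-trans (subst (r ℕ.^ suc e ∣_) (sym n≡rᵉm) (m∣m*n m)) n∣)
          z , z-order = rec m<n (∣-trans (subst (m ∣_) (sym n≡rᵉm) (n∣m*n (r ℕ.^ suc e))) n∣)
      in y * z , subst (HasOrder (y * z)) (sym n≡rᵉm)
           (hasOrder-* (coprime-^ˡ (suc e) (∤⇒coprime r-prime r∤m)) y-order z-order)
      where
      m≢0 : NonZero m
      m≢0 = ℕ.m*n≢0⇒n≢0 (r ℕ.^ suc e) {{subst NonZero n≡rᵉm _}}
      instance _ = prime⇒nonTrivial r-prime
      m<n : m < n
      m<n = subst (m <_) (trans (ℕ.*-comm m (r ℕ.^ suc e)) (sym n≡rᵉm)) (ℕ.m<m*n m (r ℕ.^ suc e) {{m≢0}}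
        (ℕ.<-≤-trans (ℕ.nonTrivial⇒n>1 r) (ℕ.m≤m*n r (r ℕ.^ e) {{ℕ.m^n≢0 r e {{prime⇒nonZero r-prime}}}})))

  ^-injective : ∀ {x} n → .{{NonZero n}} → HasOrder x n →
                Injective _≡_ _≡_ (λ (i : Fin n) → x ^ toℕ i)
  ^-injective {x} n x-order@(_ , minimal) {i} {j} eq =
    case Fin.<-cmp i j of λ where
      (tri< i<j _ _) → contradiction eq (distinct i<j)
      (tri≈ _ i≡j _) → i≡j
      (tri> _ _ j<i) → contradiction (sym eq) (distinct j<i)
    where
    distinct : ∀ {i j : Fin n} → i Fin.< j → x ^ toℕ i ≢ x ^ toℕ j
    distinct {i} {j} i<j eq = ℕ.<⇒≱ (ℕ.≤-<-trans (ℕ.m∸n≤m (toℕ j) (toℕ i)) (toℕ<n j))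
      (∣⇒≤ {{ℕ.>-nonZero (ℕ.m<n⇒0<n∸m i<j)}} (minimal (toℕ j ∸ toℕ i)
        (sym (*-nonzero-cancelˡ (x ^ toℕ i) (^-nonzero (toℕ i) (hasOrder⇒≢0 n x-order)) (begin
          x ^ toℕ i * 1#                       ≡⟨ *-identityʳ _ ⟩
          x ^ toℕ i                            ≡⟨ eq ⟩
          x ^ toℕ j                            ≡⟨ cong (x ^_) (ℕ.m+[n∸m]≡n (ℕ.<⇒≤ i<j)) ⟨
          x ^ (toℕ i ℕ.+ (toℕ j ∸ toℕ i))      ≡⟨ ^-homo-* x (toℕ i) (toℕ j ∸ toℕ i) ⟩
          x ^ toℕ i * x ^ (toℕ j ∸ toℕ i) ∎)))))

  -- Otherwise y and the n powers of x would be n + 1 roots of Xⁿ - 1.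
  ≡1⇒∃^ : ∀ {x y} n → .{{NonZero n}} → HasOrder x n → y ^ n ≡ 1# → ∃[ i ] x ^ i ≡ y
  ≡1⇒∃^ {x} {y} n x-order@(xⁿ≡1 , _) yⁿ≡1 with any? (λ (i : Fin n) → x ^ toℕ i ≟ y)
  ... | yes (i , eq) = toℕ i , eq
  ... | no  none     = contradiction (unity-bound ρ ρ-inj ρⁿ≡1) (ℕ.<⇒≱ (ℕ.n<1+n n))
    where
    ρ : Fin (suc n) → Fin q
    ρ zero    = y
    ρ (suc i) = x ^ toℕ i
    ρ-inj : Injective _≡_ _≡_ ρ
    ρ-inj {zero}  {zero}  eq = refl
    ρ-inj {zero}  {suc j} eq = contradiction (j , sym eq) none
    ρ-inj {suc i} {zero}  eq = contradiction (i , eq) none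
    ρ-inj {suc i} {suc j} eq = cong suc (^-injective n x-order eq)
    ρⁿ≡1 : ∀ i → ρ i ^ n ≡ 1#
    ρⁿ≡1 zero    = yⁿ≡1
    ρⁿ≡1 (suc i) = trans (^-assocʳ x (toℕ i) n) (^-∣-≡1 (n∣m*n (toℕ i)) xⁿ≡1)

-- Enumerating vectors

decode : ∀ {n} u → Fin (n ℕ.^ u) → Vec (Fin n) u
decode zero    i = []
decode {n} (suc u) i = proj₁ (remQuot {n} (n ℕ.^ u) i) ∷ decode u (proj₂ (remQuot {n} (n ℕ.^ u) i))

encode : ∀ {n u} → Vec (Fin n) u → Fin (n ℕ.^ u)
encode []      = zero
encode (a ∷ v) = combine a (encode v)

decode-encode : ∀ {n u} (v : Vec (Fin n) u) → decode u (encode v) ≡ v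
decode-encode [] = refl
decode-encode {n} {suc u} (a ∷ v) =
  trans (cong (λ i → proj₁ i ∷ decode u (proj₂ i)) (remQuot-combine {n} a (encode v)))
        (cong (a ∷_) (decode-encode v))

decode-injective : ∀ {n} u → Injective _≡_ _≡_ (decode {n} u)
decode-injective zero {zero} {zero} eq = refl
decode-injective {n} (suc u) {i} {j} eq = begin
    i                                ≡⟨ combine-remQuot {n} (n ℕ.^ u) i ⟨
    combine (proj₁ i′) (proj₂ i′)
      ≡⟨ cong₂ combine (proj₁ (∷-injective eq)) (decode-injective u (proj₂ (∷-injective eq))) ⟩
    combine (proj₁ j′) (proj₂ j′)    ≡⟨ combine-remQuot {n} (n ℕ.^ u) j ⟩
    j ∎
  where
  open ≡.≡-Reasoning
  i′ = remQuot {n} (n ℕ.^ u) i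
  j′ = remQuot {n} (n ℕ.^ u) j

anyVec? : ∀ {n u} {P : Vec (Fin n) u → Set} → (∀ v → Dec (P v)) → Dec (∃[ v ] P v)
anyVec? {u = u} {P} P? with any? (λ i → P? (decode u i))
... | yes (i , Pi) = yes (decode u i , Pi)
... | no  none     = no λ (v , Pv) → none (encode v , subst P (sym (decode-encode v)) Pv)

-- Scalars, embeddings and coefficient vectors.

record Scalars (n : ℕ) : Set where
  infixl 7 _*_
  infixl 6 _+_
  field
    _+_ _*_ : Fin n → Fin n → Fin n
    0# 1#   : Fin n

  infixr 8 _·_ _^_
  _·_ _^_ : Fin n → ℕ → Fin n
  a · zero  = 0#
  a · suc k = a + a · k
  a ^ zero  = 1#
  a ^ suc k = a * a ^ k

-- Only an embedding into a field makes a ring of the scalars, so a single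
-- family of scalars can be evaluated in several fields.
record Embedding {n q} (R : Scalars n) (K : FieldOn q) : Set where
  private
    module R = Scalars R
    module K = FieldOn K
  field
    ⟦_⟧       : Fin n → Fin q
    injective : Injective _≡_ _≡_ ⟦_⟧
    +-homo    : ∀ a b → ⟦ a R.+ b ⟧ ≡ ⟦ a ⟧ K.+ ⟦ b ⟧
    *-homo    : ∀ a b → ⟦ a R.* b ⟧ ≡ ⟦ a ⟧ K.* ⟦ b ⟧
    0-homo    : ⟦ R.0# ⟧ ≡ K.0#
    1-homo    : ⟦ R.1# ⟧ ≡ K.1#

  ·-homo : ∀ a k → ⟦ a R.· k ⟧ ≡ k K.· ⟦ a ⟧
  ·-homo a zero    = 0-homo
  ·-homo a (suc k) = trans (+-homo a _) (cong (⟦ a ⟧ K.+_) (·-homo a k))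

  ^-homo : ∀ a k → ⟦ a R.^ k ⟧ ≡ ⟦ a ⟧ K.^ k
  ^-homo a zero    = 1-homo
  ^-homo a (suc k) = trans (*-homo a _) (cong (⟦ a ⟧ K.*_) (^-homo a k))

-- Coefficient vectors, with the coefficient of the highest power first.
module Coefficients {n} (R : Scalars n) where
  open Scalars R

  infixl 6 _⊹_
  _⊹_ : ∀ {u} → Vec (Fin n) u → Vec (Fin n) u → Vec (Fin n) u
  _⊹_ = Vec.zipWith _+_

  scale : ∀ {u} → Fin n → Vec (Fin n) u → Vec (Fin n) u
  scale a = Vec.map (a *_)

  𝟎 : ∀ {u} → Vec (Fin n) u
  𝟎 = Vec.replicate _ 0#

  𝟏 : ∀ {u} → .{{NonZero u}} → Vec (Fin n) u
  𝟏 {suc u} = 𝟎 ∷ʳ 1#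

  -- Multiplication modulo the polynomial Xᵘ - μ.
  module _ {u} (μ : Vec (Fin n) u) where
    -- The length u is a parameter and cannot be split, hence the separate k. The leading
    -- coefficient a turns into a μ and the others move up one place.
    timesX : ∀ {k} → Vec (Fin n) k → (k ≡ u) → Vec (Fin n) u
    timesX []      refl = []
    timesX (a ∷ v) refl = scale a μ ⊹ (v ∷ʳ 0#)

    timesX^ : ℕ → Vec (Fin n) u → Vec (Fin n) u
    timesX^ zero    v = v
    timesX^ (suc k) v = timesX (timesX^ k v) refl

    times : ∀ {k} → Vec (Fin n) k → Vec (Fin n) u → Vec (Fin n) u
    times []              w = 𝟎
    times {suc k} (a ∷ v) w = scale a (timesX^ k w) ⊹ times v w

-- Evaluation of coefficient vectors, independence and spans.

module Evaluation {n q} {R : Scalars n} {K : FieldOn q} (ι : Embedding R K) where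
  open FieldOn K
  open FieldProperties K
  open Embedding ι
  open Coefficients R
  private module R = Scalars R
  open SemiringSolver commutativeSemiring using (solve; _:+_; _:*_; _:=_; con)
  open RingProperties ring using (+-cancelˡ)
  open ≡.≡-Reasoning

  eval : ∀ {u} → Fin q → Vec (Fin n) u → Fin q
  eval x []              = 0#
  eval {suc u} x (a ∷ v) = ⟦ a ⟧ * x ^ u + eval x v

  eval-⊹ : ∀ {u} x (v w : Vec _ u) → eval x (v ⊹ w) ≡ eval x v + eval x w
  eval-⊹ x [] [] = sym (+-identityˡ 0#)
  eval-⊹ {suc u} x (a ∷ v) (b ∷ w) = begin
    ⟦ a R.+ b ⟧ * x ^ u + eval x (v ⊹ w)
      ≡⟨ cong₂ (λ y z → y * x ^ u + z) (+-homo a b) (eval-⊹ x v w) ⟩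
    (⟦ a ⟧ + ⟦ b ⟧) * x ^ u + (eval x v + eval x w)
      ≡⟨ solve 5 (λ a b x v w → (a :+ b) :* x :+ (v :+ w) := (a :* x :+ v) :+ (b :* x :+ w))
            refl ⟦ a ⟧ ⟦ b ⟧ (x ^ u) (eval x v) (eval x w) ⟩
    ⟦ a ⟧ * x ^ u + eval x v + (⟦ b ⟧ * x ^ u + eval x w) ∎

  eval-scale : ∀ {u} x a (v : Vec _ u) → eval x (scale a v) ≡ ⟦ a ⟧ * eval x v
  eval-scale x a [] = sym (zeroʳ ⟦ a ⟧)
  eval-scale {suc u} x a (b ∷ v) = begin
    ⟦ a R.* b ⟧ * x ^ u + eval x (scale a v)      ≡⟨ cong₂ (λ y z → y * x ^ u + z) (*-homo a b) (eval-scale x a v) ⟩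
    ⟦ a ⟧ * ⟦ b ⟧ * x ^ u + ⟦ a ⟧ * eval x v
      ≡⟨ solve 4 (λ a b x v → a :* b :* x :+ a :* v := a :* (b :* x :+ v)) refl ⟦ a ⟧ ⟦ b ⟧ (x ^ u) (eval x v) ⟩
    ⟦ a ⟧ * (⟦ b ⟧ * x ^ u + eval x v) ∎

  eval-𝟎 : ∀ u x → eval x (𝟎 {u}) ≡ 0#
  eval-𝟎 zero    x = refl
  eval-𝟎 (suc u) x = begin
    ⟦ R.0# ⟧ * x ^ u + eval x (𝟎 {u})  ≡⟨ cong₂ (λ y z → y * x ^ u + z) 0-homo (eval-𝟎 u x) ⟩
    0# * x ^ u + 0#                    ≡⟨ +-identityʳ _ ⟩
    0# * x ^ u                         ≡⟨ zeroˡ _ ⟩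
    0# ∎

  eval-∷ʳ : ∀ {u} x (v : Vec _ u) a → eval x (v ∷ʳ a) ≡ x * eval x v + ⟦ a ⟧
  eval-∷ʳ x [] a = solve 2 (λ x a → a :* con 1 :+ con 0 := x :* con 0 :+ a) refl x ⟦ a ⟧
  eval-∷ʳ {suc u} x (b ∷ v) a = begin
    ⟦ b ⟧ * (x * x ^ u) + eval x (v ∷ʳ a)         ≡⟨ cong (⟦ b ⟧ * (x * x ^ u) +_) (eval-∷ʳ x v a) ⟩
    ⟦ b ⟧ * (x * x ^ u) + (x * eval x v + ⟦ a ⟧)
      ≡⟨ solve 5 (λ b x y v a → b :* (x :* y) :+ (x :* v :+ a) := x :* (b :* y :+ v) :+ a)
            refl ⟦ b ⟧ x (x ^ u) (eval x v) ⟦ a ⟧ ⟩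
    x * (⟦ b ⟧ * x ^ u + eval x v) + ⟦ a ⟧ ∎

  eval-𝟏 : ∀ {u} .{{_ : NonZero u}} x → eval x (𝟏 {u}) ≡ 1#
  eval-𝟏 {suc u} x = begin
    eval x (𝟎 {u} ∷ʳ R.1#)          ≡⟨ eval-∷ʳ x (𝟎 {u}) R.1# ⟩
    x * eval x (𝟎 {u}) + ⟦ R.1# ⟧   ≡⟨ cong₂ (λ y z → x * y + z) (eval-𝟎 u x) 1-homo ⟩
    x * 0# + 1#                     ≡⟨ cong (_+ 1#) (zeroʳ x) ⟩
    0# + 1#                         ≡⟨ +-identityˡ 1# ⟩
    1# ∎

  eval-timesX : ∀ {k} x (μ : Vec _ (suc k)) a (v : Vec _ k) →
                eval x (timesX μ (a ∷ v) refl) ≡ ⟦ a ⟧ * eval x μ + x * eval x v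
  eval-timesX x μ a v = begin
    eval x (scale a μ ⊹ (v ∷ʳ R.0#))              ≡⟨ eval-⊹ x (scale a μ) (v ∷ʳ R.0#) ⟩
    eval x (scale a μ) + eval x (v ∷ʳ R.0#)       ≡⟨ cong₂ _+_ (eval-scale x a μ) (eval-∷ʳ x v R.0#) ⟩
    ⟦ a ⟧ * eval x μ + (x * eval x v + ⟦ R.0# ⟧)  ≡⟨ cong (λ z → ⟦ a ⟧ * eval x μ + (x * eval x v + z)) 0-homo ⟩
    ⟦ a ⟧ * eval x μ + (x * eval x v + 0#)        ≡⟨ cong (⟦ a ⟧ * eval x μ +_) (+-identityʳ _) ⟩
    ⟦ a ⟧ * eval x μ + x * eval x v ∎

  module Root {u} (x : Fin q) (μ : Vec (Fin n) u) (xᵘ≡μ : x ^ u ≡ eval x μ) where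

    eval-timesX-root : ∀ v → eval x (timesX μ v refl) ≡ x * eval x v
    eval-timesX-root v = go v refl
      where
      go : ∀ {k} (v : Vec _ k) (eq : k ≡ u) → eval x (timesX μ v eq) ≡ x * eval x v
      go [] refl = sym (zeroʳ x)
      go {suc k} (a ∷ v) refl = begin
        eval x (timesX μ (a ∷ v) refl)            ≡⟨ eval-timesX x μ a v ⟩
        ⟦ a ⟧ * eval x μ + x * eval x v           ≡⟨ cong (λ z → ⟦ a ⟧ * z + x * eval x v) xᵘ≡μ ⟨
        ⟦ a ⟧ * (x * x ^ k) + x * eval x v
          ≡⟨ solve 4 (λ a x y v → a :* (x :* y) :+ x :* v := x :* (a :* y :+ v)) refl ⟦ a ⟧ x (x ^ k) (eval x v) ⟩
        x * (⟦ a ⟧ * x ^ k + eval x v) ∎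

    eval-timesX^ : ∀ k v → eval x (timesX^ μ k v) ≡ x ^ k * eval x v
    eval-timesX^ zero    v = sym (*-identityˡ _)
    eval-timesX^ (suc k) v = begin
      eval x (timesX μ (timesX^ μ k v) refl) ≡⟨ eval-timesX-root (timesX^ μ k v) ⟩
      x * eval x (timesX^ μ k v)             ≡⟨ cong (x *_) (eval-timesX^ k v) ⟩
      x * (x ^ k * eval x v)                 ≡⟨ *-assoc x (x ^ k) (eval x v) ⟨
      x ^ suc k * eval x v ∎

    -- The product of coordinate vectors depends on μ alone, so it computes products at any root of
    -- Xᵘ - μ, in whichever field that root lies.
    eval-times : ∀ {k} (v : Vec _ k) w → eval x (times μ v w) ≡ eval x v * eval x w
    eval-times [] w = trans (eval-𝟎 u x) (sym (zeroˡ _))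
    eval-times {suc k} (a ∷ v) w = begin
      eval x (scale a (timesX^ μ k w) ⊹ times μ v w)
        ≡⟨ eval-⊹ x (scale a (timesX^ μ k w)) (times μ v w) ⟩
      eval x (scale a (timesX^ μ k w)) + eval x (times μ v w)
        ≡⟨ cong₂ _+_ (eval-scale x a (timesX^ μ k w)) (eval-times v w) ⟩
      ⟦ a ⟧ * eval x (timesX^ μ k w) + eval x v * eval x w
        ≡⟨ cong (λ z → ⟦ a ⟧ * z + eval x v * eval x w) (eval-timesX^ k w) ⟩
      ⟦ a ⟧ * (x ^ k * eval x w) + eval x v * eval x w
        ≡⟨ solve 4 (λ a y v w → a :* (y :* w) :+ v :* w := (a :* y :+ v) :* w)
              refl ⟦ a ⟧ (x ^ k) (eval x v) (eval x w) ⟩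
      (⟦ a ⟧ * x ^ k + eval x v) * eval x w ∎

  private
    -- `Scalars` has no negation; q - 1 copies of 1 serve as -1.
    1+[q-1]·1≡0 : 1# + ⟦ R.1# R.· (q ∸ 1) ⟧ ≡ 0#
    1+[q-1]·1≡0 = begin
      1# + ⟦ R.1# R.· (q ∸ 1) ⟧   ≡⟨ cong (1# +_) (·-homo R.1# (q ∸ 1)) ⟩
      1# + (q ∸ 1) · ⟦ R.1# ⟧     ≡⟨ cong (λ y → 1# + (q ∸ 1) · y) 1-homo ⟩
      suc (q ∸ 1) · 1#            ≡⟨ cong (_· 1#) (ℕ.suc-pred q {{nonZeroIndex 0#}}) ⟩
      q · 1#                      ≡⟨ q·x≡0 1# ⟩
      0# ∎

  difference : ∀ a b → ∃[ d ] ⟦ a ⟧ ≡ ⟦ d ⟧ + ⟦ b ⟧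
  difference a b = a R.+ m R.* b , sym (begin
      ⟦ a R.+ m R.* b ⟧ + ⟦ b ⟧        ≡⟨ cong (_+ ⟦ b ⟧) (trans (+-homo a _) (cong (⟦ a ⟧ +_) (*-homo m b))) ⟩
      ⟦ a ⟧ + ⟦ m ⟧ * ⟦ b ⟧ + ⟦ b ⟧
        ≡⟨ solve 3 (λ a m b → a :+ m :* b :+ b := a :+ (con 1 :+ m) :* b) refl ⟦ a ⟧ ⟦ m ⟧ ⟦ b ⟧ ⟩
      ⟦ a ⟧ + (1# + ⟦ m ⟧) * ⟦ b ⟧     ≡⟨ cong (λ z → ⟦ a ⟧ + z * ⟦ b ⟧) 1+[q-1]·1≡0 ⟩
      ⟦ a ⟧ + 0# * ⟦ b ⟧               ≡⟨ cong (⟦ a ⟧ +_) (zeroˡ _) ⟩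
      ⟦ a ⟧ + 0#                       ≡⟨ +-identityʳ _ ⟩
      ⟦ a ⟧ ∎)
    where m = R.1# R.· (q ∸ 1)

  difference-eval : ∀ {u} x (v w : Vec _ u) → ∃[ d ] eval x v ≡ eval {u} x d + eval x w
  difference-eval x [] [] = [] , sym (+-identityˡ 0#)
  difference-eval {suc u} x (a ∷ v) (b ∷ w) =
    let d , ⟦a⟧≡ = difference a b
        e , v≡ = difference-eval x v w
    in  d ∷ e , (begin
      ⟦ a ⟧ * x ^ u + eval x v                           ≡⟨ cong₂ (λ y z → y * x ^ u + z) ⟦a⟧≡ v≡ ⟩
      (⟦ d ⟧ + ⟦ b ⟧) * x ^ u + (eval x e + eval x w)
        ≡⟨ solve 5 (λ a b x v w → (a :+ b) :* x :+ (v :+ w) := (a :* x :+ v) :+ (b :* x :+ w))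
              refl ⟦ d ⟧ ⟦ b ⟧ (x ^ u) (eval x e) (eval x w) ⟩
      ⟦ d ⟧ * x ^ u + eval x e + (⟦ b ⟧ * x ^ u + eval x w) ∎)

  -- The power a ^ (q - 2) can be formed inside the scalars and is the inverse by Fermat.
  reciprocal : ∀ a → ⟦ a ⟧ ≢ 0# → ∃[ b ] ⟦ b ⟧ * ⟦ a ⟧ ≡ 1#
  reciprocal a a≢0 = a R.^ (q ∸ 1 ∸ 1) , (begin
      ⟦ a R.^ (q ∸ 1 ∸ 1) ⟧ * ⟦ a ⟧  ≡⟨ cong (_* ⟦ a ⟧) (^-homo a (q ∸ 1 ∸ 1)) ⟩
      ⟦ a ⟧ ^ (q ∸ 1 ∸ 1) * ⟦ a ⟧    ≡⟨ *-comm _ ⟦ a ⟧ ⟩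
      ⟦ a ⟧ ^ suc (q ∸ 1 ∸ 1)        ≡⟨ cong (⟦ a ⟧ ^_) (ℕ.suc-pred (q ∸ 1) {{q-1≢0}}) ⟩
      ⟦ a ⟧ ^ (q ∸ 1)                ≡⟨ x^[q-1]≡1 a≢0 ⟩
      1# ∎)

  -- Linear independence of 1, x, ..., xᵘ⁻¹, put as injectivity so that it can be played against
  -- cardinalities.
  Independent : ℕ → Fin q → Set
  Independent u x = Injective _≡_ _≡_ (eval {u} x)

  -- A coincidence between vectors with different leading coefficients could be solved for x ^ u.
  independent-suc : ∀ {u x} → Independent u x → (∀ v → x ^ u ≢ eval x v) → Independent (suc u) x
  independent-suc {u} {x} ind xᵘ∉ {a ∷ v} {b ∷ w} eq with a ≟ b
  ... | yes refl = cong (a ∷_) (ind (+-cancelˡ _ _ _ eq))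
  ... | no  a≢b  = contradiction xᵘ≡ (xᵘ∉ (scale c e))
    where
    d = proj₁ (difference a b)
    ⟦a⟧≡ = proj₂ (difference a b)
    e = proj₁ (difference-eval x w v)
    w≡ = proj₂ (difference-eval x w v)
    ⟦d⟧≢0 : ⟦ d ⟧ ≢ 0#
    ⟦d⟧≢0 ⟦d⟧≡0 = a≢b (injective (trans ⟦a⟧≡ (trans (cong (_+ ⟦ b ⟧) ⟦d⟧≡0) (+-identityˡ _))))
    c = proj₁ (reciprocal d ⟦d⟧≢0)
    dxᵘ≡e : ⟦ d ⟧ * x ^ u ≡ eval x e
    dxᵘ≡e = +-cancelˡ (⟦ b ⟧ * x ^ u + eval x v) _ _ (begin
      ⟦ b ⟧ * x ^ u + eval x v + ⟦ d ⟧ * x ^ u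
        ≡⟨ solve 4 (λ b x v d → b :* x :+ v :+ d :* x := (d :+ b) :* x :+ v) refl ⟦ b ⟧ (x ^ u) (eval x v) ⟦ d ⟧ ⟩
      (⟦ d ⟧ + ⟦ b ⟧) * x ^ u + eval x v         ≡⟨ cong (λ y → y * x ^ u + eval x v) ⟦a⟧≡ ⟨
      ⟦ a ⟧ * x ^ u + eval x v                   ≡⟨ eq ⟩
      ⟦ b ⟧ * x ^ u + eval x w                   ≡⟨ cong (⟦ b ⟧ * x ^ u +_) w≡ ⟩
      ⟦ b ⟧ * x ^ u + (eval x e + eval x v)
        ≡⟨ solve 3 (λ b v e → b :+ (e :+ v) := b :+ v :+ e) refl (⟦ b ⟧ * x ^ u) (eval x v) (eval x e) ⟩
      ⟦ b ⟧ * x ^ u + eval x v + eval x e ∎)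
    xᵘ≡ : x ^ u ≡ eval x (scale c e)
    xᵘ≡ = begin
      x ^ u                      ≡⟨ *-identityˡ _ ⟨
      1# * x ^ u                 ≡⟨ cong (_* x ^ u) (proj₂ (reciprocal d ⟦d⟧≢0)) ⟨
      ⟦ c ⟧ * ⟦ d ⟧ * x ^ u      ≡⟨ *-assoc ⟦ c ⟧ ⟦ d ⟧ _ ⟩
      ⟦ c ⟧ * (⟦ d ⟧ * x ^ u)    ≡⟨ cong (⟦ c ⟧ *_) dxᵘ≡e ⟩
      ⟦ c ⟧ * eval x e           ≡⟨ eval-scale x c e ⟨
      eval x (scale c e) ∎

  independent⇒≤ : ∀ {u x} → Independent u x → n ℕ.^ u ≤ q
  independent⇒≤ {u} ind = injective⇒≤ (decode-injective u ∘ ind)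

  private
    1<n : 1 < n
    1<n = distinct⇒1<n λ 1≡0 → 1≢0 (trans (sym 1-homo) (trans (cong ⟦_⟧ 1≡0) 0-homo))

    u<nᵘ : ∀ u → u < n ℕ.^ u
    u<nᵘ zero    = s≤s z≤n
    u<nᵘ (suc u) = ℕ.≤-<-trans (u<nᵘ u) (subst (n ℕ.^ u <_) (ℕ.*-comm (n ℕ.^ u) n)
      (ℕ.m<m*n (n ℕ.^ u) n {{ℕ.m^n≢0 n u {{ℕ.>-nonZero (ℕ.<-trans (s≤s z≤n) 1<n)}}}} 1<n))

  -- The u found is the degree of x, and Xᵘ - μ its minimal polynomial. The search ends because
  -- independence forces n ^ u ≤ q, which is false at u = q.
  minimalRelation : ∀ x → ∃[ u ] Independent u x × ∃[ μ ] x ^ u ≡ eval {u} x μ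
  minimalRelation x = search q 0 (ℕ.+-identityʳ q) ind₀
    where
    ind₀ : Independent 0 x
    ind₀ {[]} {[]} _ = refl
    search : ∀ fuel u → fuel ℕ.+ u ≡ q → Independent u x →
             ∃[ u ] Independent u x × ∃[ μ ] x ^ u ≡ eval {u} x μ
    search zero u refl ind = contradiction (independent⇒≤ ind) (ℕ.<⇒≱ (u<nᵘ u))
    search (suc fuel) u eq ind with anyVec? (λ μ → x ^ u ≟ eval {u} x μ)
    ... | yes relation = u , ind , relation
    ... | no  none     = search fuel (suc u) (trans (ℕ.+-suc fuel u) eq)
                           (independent-suc ind λ v xᵘ≡v → none (v , xᵘ≡v))

  -- The span of 1, x, …, xᵘ⁻¹ is closed under multiplication by x, which
  -- therefore permutes its nonzero elements.
  span-lagrange : ∀ {u} .{{_ : NonZero u}} {x} → x ≢ 0# → Independent u x →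
                  (μ : Vec _ u) → x ^ u ≡ eval x μ → x ^ (n ℕ.^ u ∸ 1) ≡ 1#
  span-lagrange {u} {x} x≢0 ind μ xᵘ≡μ = lagrange (eval x ∘ decode u) (decode-injective u ∘ ind)
    (encode (𝟎 {u}) , trans (cong (eval x) (decode-encode (𝟎 {u}))) (eval-𝟎 u x)) x≢0
    λ i → encode (timesX μ (decode u i) refl) ,
          trans (cong (eval x) (decode-encode (timesX μ (decode u i) refl))) (eval-timesX-root (decode u i))
    where open Root x μ xᵘ≡μ

  independent⇒spanning : ∀ {u x} → Independent u x → q ≤ n ℕ.^ u → ∀ y → ∃[ v ] eval {u} x v ≡ y
  independent⇒spanning {u} {x} ind q≤nᵘ y =
    let i , eq = injective⇒surjective (eval x ∘ decode u) (decode-injective u ∘ ind) q≤nᵘ y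
    in  decode u i , eq

-- The scalars in use, and the prime field inside a field of pᵃ elements.

fieldScalars : ∀ {q} → FieldOn q → Scalars q
fieldScalars K = record { _+_ = _+_ ; _*_ = _*_ ; 0# = 0# ; 1# = 1# }
  where open FieldOn K

modularScalars : ∀ p → .{{NonZero p}} → Scalars p
modularScalars p = record
  { _+_ = λ a b → (toℕ a ℕ.+ toℕ b) mod p
  ; _*_ = λ a b → (toℕ a ℕ.* toℕ b) mod p
  ; 0#  = 0 mod p
  ; 1#  = 1 mod p
  }

module PrimeField {p} (p-prime : Prime p) where
  private instance _ = prime⇒nonZero p-prime

  -- From (p · 1) ^ a = q · 1 = 0 follows p · 1 = 0, and by Bézout m · 1 = 0 only for multiples m of
  -- p. The formula is returned as well, since it exhibits the scalars as repeated sums of 1.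
  primeEmbedding : ∀ {q} a → q ≡ p ℕ.^ a → (K : FieldOn q) → let open FieldOn K in
    ∃[ ι ] (∀ i → Embedding.⟦_⟧ {R = modularScalars p} {K} ι i ≡ toℕ i · 1#)
  primeEmbedding a q≡pᵃ K = record
    { ⟦_⟧       = λ i → toℕ i · 1#
    ; injective = ·1-injective
    ; +-homo    = λ i j → trans (mod-· (toℕ i ℕ.+ toℕ j)) (×-homo-+ 1# (toℕ i) (toℕ j))
    ; *-homo    = λ i j → trans (mod-· (toℕ i ℕ.* toℕ j)) (×1-homo-* (toℕ i) (toℕ j))
    ; 0-homo    = mod-· 0
    ; 1-homo    = trans (mod-· 1) (+-identityʳ 1#)
    } , λ i → refl
    where
    open FieldOn K
    open FieldProperties K
    open RingProperties ring using (+-cancelˡ)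
    open ≡.≡-Reasoning

    p^-·1 : ∀ a → (p ℕ.^ a) · 1# ≡ (p · 1#) ^ a
    p^-·1 zero    = +-identityʳ 1#
    p^-·1 (suc a) = trans (×1-homo-* p (p ℕ.^ a)) (cong (p · 1# *_) (p^-·1 a))

    p·1≡0 : p · 1# ≡ 0#
    p·1≡0 = decidable-stable (p · 1# ≟ 0#) λ p·1≢0 →
      ^-nonzero a p·1≢0 (trans (sym (p^-·1 a)) (trans (cong (_· 1#) (sym q≡pᵃ)) (q·x≡0 1#)))

    ∣⇒·1≡0 : ∀ {m n} → m · 1# ≡ 0# → m ∣ n → n · 1# ≡ 0#
    ∣⇒·1≡0 {m} m·1≡0 (divides k refl) = begin
      (k ℕ.* m) · 1#       ≡⟨ ×1-homo-* k m ⟩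
      k · 1# * m · 1#      ≡⟨ cong (k · 1# *_) m·1≡0 ⟩
      k · 1# * 0#          ≡⟨ zeroʳ _ ⟩
      0# ∎

    mod-· : ∀ m → toℕ (m mod p) · 1# ≡ m · 1#
    mod-· m = begin
      toℕ (m mod p) · 1#                                   ≡⟨ cong (_· 1#) (toℕ-fromℕ< (m%n<n m p)) ⟩
      (m ℕ.% p) · 1#                                       ≡⟨ +-identityʳ _ ⟨
      (m ℕ.% p) · 1# + 0#
        ≡⟨ cong ((m ℕ.% p) · 1# +_) (∣⇒·1≡0 p·1≡0 (n∣m*n (m ℕ./ p))) ⟨
      (m ℕ.% p) · 1# + (m ℕ./ p ℕ.* p) · 1#                ≡⟨ ×-homo-+ 1# (m ℕ.% p) (m ℕ./ p ℕ.* p) ⟨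
      (m ℕ.% p ℕ.+ m ℕ./ p ℕ.* p) · 1#                     ≡⟨ cong (_· 1#) (m≡m%n+[m/n]*n m p) ⟨
      m · 1# ∎

    ¬both : ∀ m n k l → m · 1# ≡ 0# → n · 1# ≡ 0# → suc (l ℕ.* n) ≢ k ℕ.* m
    ¬both m n k l m·1≡0 n·1≡0 eq = 1≢0 (begin
      1#                        ≡⟨ +-identityʳ 1# ⟨
      1# + 0#                   ≡⟨ cong (1# +_) (∣⇒·1≡0 n·1≡0 (n∣m*n l)) ⟨
      suc (l ℕ.* n) · 1#        ≡⟨ cong (_· 1#) eq ⟩
      (k ℕ.* m) · 1#            ≡⟨ ∣⇒·1≡0 m·1≡0 (n∣m*n k) ⟩
      0# ∎)

    ·1≡0⇒∣ : ∀ m → m · 1# ≡ 0# → p ∣ m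
    ·1≡0⇒∣ m m·1≡0 = decidable-stable (p ∣? m) λ p∤m →
      case coprime-Bézout (∤⇒coprime p-prime p∤m) of λ where
        (Bézout.+- k l eq) → ¬both p m k l p·1≡0 m·1≡0 eq
        (Bézout.-+ k l eq) → ¬both m p l k m·1≡0 p·1≡0 eq

    distinct : ∀ {i j : Fin p} → i Fin.< j → toℕ i · 1# ≢ toℕ j · 1#
    distinct {i} {j} i<j eq = ℕ.<⇒≱ (ℕ.≤-<-trans (ℕ.m∸n≤m (toℕ j) (toℕ i)) (toℕ<n j))
      (∣⇒≤ {{ℕ.>-nonZero (ℕ.m<n⇒0<n∸m i<j)}} (·1≡0⇒∣ (toℕ j ∸ toℕ i) (+-cancelˡ (toℕ i · 1#) _ _ (begin
        toℕ i · 1# + (toℕ j ∸ toℕ i) · 1#  ≡⟨ ×-homo-+ 1# (toℕ i) (toℕ j ∸ toℕ i) ⟨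
        (toℕ i ℕ.+ (toℕ j ∸ toℕ i)) · 1#   ≡⟨ cong (_· 1#) (ℕ.m+[n∸m]≡n (ℕ.<⇒≤ i<j)) ⟩
        toℕ j · 1#                         ≡⟨ eq ⟨
        toℕ i · 1#                         ≡⟨ +-identityʳ _ ⟨
        toℕ i · 1# + 0# ∎))))

    ·1-injective : Injective _≡_ _≡_ (λ (i : Fin p) → toℕ i · 1#)
    ·1-injective {i} {j} eq = case Fin.<-cmp i j of λ where
      (tri< i<j _ _) → contradiction eq (distinct i<j)
      (tri≈ _ i≡j _) → i≡j
      (tri> _ _ j<i) → contradiction (sym eq) (distinct j<i)

-- Embedding F_q into F_Q by a root of the minimal polynomial of ζ.

module Extension
  {n q Q} {R : Scalars n} {F : FieldOn q} {G : FieldOn Q}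
  (ιF : Embedding R F) (ιG : Embedding R G) where

  private
    module F where
      open FieldOn F public
      open FieldProperties F public
      open Evaluation ιF public
    module G where
      open FieldOn G public
      open FieldProperties G public
      open Evaluation ιG public
      open Embedding ιG public
      open RingProperties ring public using (+-cancelˡ)
      open SemiringSolver commutativeSemiring public using (solve; _:+_; _:*_; _:=_)
  open Coefficients R
  open ≡.≡-Reasoning

  module _ {u} .{{_ : NonZero u}} (ζ : Fin q) (ζ≢0 : ζ ≢ F.0#) (independent : F.Independent u ζ)
           (μ : Vec (Fin n) u) (ζᵘ≡μ : ζ F.^ u ≡ F.eval ζ μ) where

    -- Division of Xᵐ⁺ᵘ by Xᵘ - μ: the remainder r is read in both fields,
    -- the monic quotient h only in G.
    power-division : ∀ m → ∃[ r ] ∃[ h ] length h ≡ m × ζ F.^ (m ℕ.+ u) ≡ F.eval {u} ζ r ×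
      (∀ x → x G.^ (m ℕ.+ u) G.+ G.eval x μ G.* G.monic h x ≡ G.eval {u} x r G.+ x G.^ u G.* G.monic h x)
    power-division zero = μ , [] , refl , ζᵘ≡μ , λ x →
      trans (cong (x G.^ u G.+_) (G.*-identityʳ _))
            (trans (G.+-comm _ _) (cong (G.eval x μ G.+_) (sym (G.*-identityʳ _))))
    power-division (suc m) =
      let r , h , |h|≡m , ζ-eq , G-eq = power-division m
          d , step′ = step r μ
      in  timesX μ r refl , G.⟦ d ⟧ ∷ h , cong suc |h|≡m ,
          trans (cong (ζ F.*_) ζ-eq) (sym (F.Root.eval-timesX-root ζ μ ζᵘ≡μ r)) ,
          λ x → step′ x (x G.^ (m ℕ.+ u)) (G.monic h x) (G-eq x)
      where
      step : ∀ {u} .{{_ : NonZero u}} (r μ : Vec (Fin n) u) → ∃[ d ] (∀ x y H →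
             y G.+ G.eval x μ G.* H ≡ G.eval x r G.+ x G.^ u G.* H →
             x G.* y G.+ G.eval x μ G.* (G.⟦ d ⟧ G.+ x G.* H) ≡
             G.eval x (timesX μ r refl) G.+ x G.^ u G.* (G.⟦ d ⟧ G.+ x G.* H))
      step {suc k} (d ∷ r) μ = d , λ x y H eq → let open G; M = eval x μ; D = ⟦ d ⟧; P = x ^ k; E = eval x r in begin
        x * y + M * (D + x * H)
          ≡⟨ solve 5 (λ x y M D H → x :* y :+ M :* (D :+ x :* H) := x :* (y :+ M :* H) :+ M :* D) refl x y M D H ⟩
        x * (y + M * H) + M * D                      ≡⟨ cong (λ z → x * z + M * D) eq ⟩
        x * (D * P + E + x * P * H) + M * D
          ≡⟨ solve 6 (λ x P M D E H → x :* (D :* P :+ E :+ x :* P :* H) :+ M :* D := D :* M :+ x :* E :+ x :* P :* (D :+ x :* H))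
                refl x P M D E H ⟩
        D * M + x * E + x * P * (D + x * H)          ≡⟨ cong (_+ x * P * (D + x * H)) (eval-timesX x μ d r) ⟨
        eval x (timesX μ (d ∷ r) refl) + x * P * (D + x * H) ∎

    -- Otherwise the monic quotient of X^(Q-1+u) - Xᵘ by Xᵘ - μ would equal 1 at
    -- all Q elements of G, although its degree is Q - 1.
    ∃root : ζ F.^ (Q ∸ 1) ≡ F.1# → ∃[ η ] η G.^ u ≡ G.eval η μ
    ∃root ζ^[Q-1]≡1 with any? (λ η → η G.^ u ≟ G.eval η μ)
    ... | yes found = found
    ... | no  none  = contradiction (too-many h |h|≡Q-1 G-eq) λ Q≤Q-1 →
        ℕ.<⇒≱ (ℕ.n<1+n (Q ∸ 1)) (subst (_≤ Q ∸ 1) (sym (ℕ.suc-pred Q {{nonZeroIndex G.0#}})) Q≤Q-1)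
      where
      division = power-division (Q ∸ 1)
      r = proj₁ division
      h = proj₁ (proj₂ division)
      |h|≡Q-1 = proj₁ (proj₂ (proj₂ division))
      -- Since ζ ^ (Q - 1) = 1, the powers of X with exponents Q - 1 + u and u leave the same
      -- remainder.
      r≡μ : r ≡ μ
      r≡μ = independent (begin
        F.eval ζ r                          ≡⟨ proj₁ (proj₂ (proj₂ (proj₂ division))) ⟨
        ζ F.^ ((Q ∸ 1) ℕ.+ u)               ≡⟨ F.^-homo-* ζ (Q ∸ 1) u ⟩
        ζ F.^ (Q ∸ 1) F.* ζ F.^ u           ≡⟨ cong₂ F._*_ ζ^[Q-1]≡1 ζᵘ≡μ ⟩
        F.1# F.* F.eval ζ μ                 ≡⟨ F.*-identityˡ _ ⟩
        F.eval ζ μ ∎)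
      -- The additional factor Xᵘ makes the identity true at 0 too.
      x^[Q-1+u]≡xᵘ : ∀ x → x G.^ ((Q ∸ 1) ℕ.+ u) ≡ x G.^ u
      x^[Q-1+u]≡xᵘ x with x ≟ G.0#
      ... | yes refl = trans (G.^-homo-* G.0# (Q ∸ 1) u)
              (trans (cong (G.0# G.^ (Q ∸ 1) G.*_) (G.0^n≡0 u)) (trans (G.zeroʳ _) (sym (G.0^n≡0 u))))
      ... | no x≢0 = trans (G.^-homo-* x (Q ∸ 1) u)
              (trans (cong (G._* x G.^ u) (G.x^[q-1]≡1 x≢0)) (G.*-identityˡ _))
      G-eq : ∀ x → x G.^ u G.+ G.eval x μ G.* G.monic h x ≡ G.eval x μ G.+ x G.^ u G.* G.monic h x
      G-eq x = begin
        x G.^ u G.+ G.eval x μ G.* G.monic h x  ≡⟨ cong (G._+ G.eval x μ G.* G.monic h x) (x^[Q-1+u]≡xᵘ x) ⟨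
        x G.^ ((Q ∸ 1) ℕ.+ u) G.+ G.eval x μ G.* G.monic h x ≡⟨ proj₂ (proj₂ (proj₂ (proj₂ division))) x ⟩
        G.eval x r G.+ x G.^ u G.* G.monic h x  ≡⟨ cong (λ v → G.eval x v G.+ x G.^ u G.* G.monic h x) r≡μ ⟩
        G.eval x μ G.+ x G.^ u G.* G.monic h x ∎
      too-many : ∀ h → length h ≡ Q ∸ 1 →
                 (∀ x → x G.^ u G.+ G.eval x μ G.* G.monic h x ≡ G.eval x μ G.+ x G.^ u G.* G.monic h x) →
                 Q ≤ Q ∸ 1
      too-many [] 0≡Q-1 _ = contradiction (sym 0≡Q-1) (ℕ.≢-nonZero⁻¹ (Q ∸ 1) {{G.q-1≢0}})
      -- As c is the constant coefficient, lowering it by 1 subtracts 1 from the polynomial and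
      -- keeps it monic of degree Q - 1. Every x is a root, because x ^ u ≢ μ(x) can be cancelled.
      too-many (c ∷ h) |h|≡Q-1 G-eq = subst (Q ≤_) |h|≡Q-1
        (G.root-bound ((G.- G.1# G.+ c) ∷ h) (λ x → x) (λ eq → eq) λ x →
          let open G; A = x ^ u; B = eval x μ; H′ = - 1# + c + x * monic h x
              H≡ : c + x * monic h x ≡ 1# + H′
              H≡ = begin
                c + x * monic h x                      ≡⟨ +-identityˡ _ ⟨
                0# + (c + x * monic h x)               ≡⟨ cong (_+ (c + x * monic h x)) (-‿inverseʳ 1#) ⟨
                1# + - 1# + (c + x * monic h x)
                  ≡⟨ solve 4 (λ o m c y → o :+ m :+ (c :+ y) := o :+ (m :+ c :+ y)) refl 1# (- 1#) c (x * monic h x) ⟩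
                1# + H′ ∎
              expand : ∀ a b → a + b * (1# + H′) ≡ a + b + b * H′
              expand a b = trans (cong (a +_) (trans (distribˡ b 1# H′) (cong (_+ b * H′) (*-identityʳ b)))) (sym (+-assoc a b (b * H′)))
          in *-distinct (λ A≡B → none (x , A≡B)) (sym (+-cancelˡ (A + B) _ _ (begin
               A + B + B * H′             ≡⟨ expand A B ⟨
               A + B * (1# + H′)          ≡⟨ cong (λ z → A + B * z) H≡ ⟨
               A + B * (c + x * monic h x)  ≡⟨ G-eq x ⟩
               B + A * (c + x * monic h x)  ≡⟨ cong (λ z → B + A * z) H≡ ⟩
               B + A * (1# + H′)          ≡⟨ expand B A ⟩
               B + A + A * H′             ≡⟨ cong (_+ A * H′) (+-comm B A) ⟩
               A + B + A * H′ ∎))))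

    -- The map sends ζ to η. It respects the operations because these act on coordinates through μ
    -- alone, and it is injective because a nonzero difference is invertible.
    extension : (∀ y → ∃[ v ] F.eval {u} ζ v ≡ y) → ζ F.^ (Q ∸ 1) ≡ F.1# → Embedding (fieldScalars F) G
    extension spanning ζ^[Q-1]≡1 = record
      { ⟦_⟧       = φ
      ; injective = φ-injective
      ; +-homo    = φ-+
      ; *-homo    = φ-*
      ; 0-homo    = trans (φ-eval (𝟎 {u}) (F.eval-𝟎 u ζ)) (G.eval-𝟎 u η)
      ; 1-homo    = φ-1
      }
      where
      η = proj₁ (∃root ζ^[Q-1]≡1)
      ηᵘ≡μ = proj₂ (∃root ζ^[Q-1]≡1)
      coords : Fin q → Vec (Fin n) u
      coords = proj₁ ∘ spanning
      eval-coords : ∀ y → F.eval ζ (coords y) ≡ y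
      eval-coords = proj₂ ∘ spanning
      φ : Fin q → Fin Q
      φ = G.eval η ∘ coords
      φ-eval : ∀ v {y} → F.eval ζ v ≡ y → φ y ≡ G.eval η v
      φ-eval v {y} eq = cong (G.eval η) (independent {coords y} {v} (trans (eval-coords y) (sym eq)))
      φ-+ : ∀ x y → φ (x F.+ y) ≡ φ x G.+ φ y
      φ-+ x y = trans
        (φ-eval (coords x ⊹ coords y) (trans (F.eval-⊹ ζ (coords x) (coords y)) (cong₂ F._+_ (eval-coords x) (eval-coords y))))
        (G.eval-⊹ η (coords x) (coords y))
      φ-* : ∀ x y → φ (x F.* y) ≡ φ x G.* φ y
      φ-* x y = trans
        (φ-eval (times μ (coords x) (coords y)) (trans (F.Root.eval-times ζ μ ζᵘ≡μ (coords x) (coords y)) (cong₂ F._*_ (eval-coords x) (eval-coords y))))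
        (G.Root.eval-times η μ ηᵘ≡μ (coords x) (coords y))
      φ-1 : φ F.1# ≡ G.1#
      φ-1 = trans (φ-eval (𝟏 {u}) (F.eval-𝟏 ζ)) (G.eval-𝟏 η)
      φ-injective : Injective _≡_ _≡_ φ
      φ-injective {x} {y} φx≡φy = decidable-stable (x ≟ y) λ x≢y →
        let d = x F.+ F.- y
            d+y≡x : d F.+ y ≡ x
            d+y≡x = trans (F.+-assoc x (F.- y) y) (trans (cong (x F.+_) (F.-‿inverseˡ y)) (F.+-identityʳ x))
            d⁻¹ , dd⁻¹≡1 = F.inverse d λ d≡0 → x≢y (trans (sym d+y≡x) (trans (cong (F._+ y) d≡0) (F.+-identityˡ y)))
            φd≡0 : φ d ≡ G.0#
            φd≡0 = G.+-cancelˡ (φ y) _ _ (begin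
              φ y G.+ φ d   ≡⟨ G.+-comm (φ y) (φ d) ⟩
              φ d G.+ φ y   ≡⟨ φ-+ d y ⟨
              φ (d F.+ y)   ≡⟨ cong φ d+y≡x ⟩
              φ x           ≡⟨ φx≡φy ⟩
              φ y           ≡⟨ G.+-identityʳ (φ y) ⟨
              φ y G.+ G.0# ∎)
        in G.1≢0 (begin
             G.1#              ≡⟨ φ-1 ⟨
             φ F.1#            ≡⟨ cong φ dd⁻¹≡1 ⟨
             φ (d F.* d⁻¹)     ≡⟨ φ-* d d⁻¹ ⟩
             φ d G.* φ d⁻¹     ≡⟨ cong (G._* φ d⁻¹) φd≡0 ⟩
             G.0# G.* φ d⁻¹    ≡⟨ G.zeroˡ _ ⟩
             G.0# ∎)

-- Sums of powers in one field and across the extension.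

least : ∀ {ℓ} {P : ℕ → Set ℓ} → (∀ n → Dec (P n)) → ∀ n → P n → ∃[ m ] IsLeast P m
least P? zero Pn = 0 , Pn , λ k _ → z≤n
least {P = P} P? (suc n) Pn with P? 0
... | yes P0 = 0 , P0 , λ k _ → z≤n
... | no ¬P0 with least (P? ∘ suc) n Pn
...   | m , Pm , minimal = suc m , Pm , minimal′
  where
  minimal′ : ∀ k → P k → suc m ≤ k
  minimal′ zero    P0 = contradiction P0 ¬P0
  minimal′ (suc k) Pk = s≤s (minimal k Pk)

module PowerSums {q} (K : FieldOn q) (k : ℕ) where
  open FieldOn K
  open FieldProperties K
  open ≡.≡-Reasoning

  IsSum : ℕ → Fin q → Set
  IsSum zero    x = x ≡ 0#
  IsSum (suc s) x = ∃[ y ] ∃[ z ] x ≡ y ^ k + z × IsSum s z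

  AllSums : ℕ → Set
  AllSums s = ∀ x → IsSum s x

  isSum? : ∀ s x → Dec (IsSum s x)
  isSum? zero    x = x ≟ 0#
  isSum? (suc s) x = any? λ y → any? λ z → (x ≟ y ^ k + z) ×-dec isSum? s z

  allSums? : ∀ s → Dec (AllSums s)
  allSums? s = all? (isSum? s)

  isSum-+ : ∀ {s t x y} → IsSum s x → IsSum t y → IsSum (s ℕ.+ t) (x + y)
  isSum-+ {zero} {t} {y = y} refl yΣ = subst (IsSum t) (sym (+-identityˡ y)) yΣ
  isSum-+ {suc s} {y = y} (w , z , refl , zΣ) yΣ = w , z + y , +-assoc (w ^ k) z y , isSum-+ zΣ yΣ

  isSum-· : ∀ n y → IsSum n (n · (y ^ k))
  isSum-· zero    y = refl
  isSum-· (suc n) y = y , n · (y ^ k) , refl , isSum-· n y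

  isSum-mono : .{{NonZero k}} → ∀ {s t x} → s ≤ t → IsSum s x → IsSum t x
  isSum-mono {t = zero} z≤n xΣ = xΣ
  isSum-mono {t = suc t} {x} z≤n xΣ =
    0# , x , sym (trans (cong (_+ x) (0^n≡0 k)) (+-identityˡ x)) , isSum-mono {t = t} z≤n xΣ
  isSum-mono (s≤s s≤t) (y , z , eq , zΣ) = y , z , eq , isSum-mono s≤t zΣ

  ∃hardest : .{{NonZero k}} → ∀ {g} → IsLeast AllSums g → ∃[ x ] (∀ s → IsSum s x → g ≤ s)
  ∃hardest {zero}  _ = 0# , λ s _ → z≤n
  ∃hardest {suc g} (_ , minimal) =
    let x , ¬xΣ = ¬∀⟶∃¬ q (IsSum g) (isSum? g) λ allSums → ℕ.<⇒≱ (ℕ.n<1+n g) (minimal g allSums)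
    in  x , λ s xΣ → ℕ.≰⇒> λ s≤g → ¬xΣ (isSum-mono s≤g xΣ)

module SumsOverExtension
  {q Q k k′ : ℕ} {F : FieldOn q} {G : FieldOn Q} (φ : Embedding (fieldScalars F) G) (θ : Fin Q)
  where
  private
    module F where
      open FieldOn F public
      open PowerSums F k public
    module G where
      open FieldOn G public
      open FieldProperties G public
      open PowerSums G k′ public
      open SemiringSolver commutativeSemiring public using (solve; _:+_; _:*_; _:=_)
  open Embedding φ
  open Evaluation φ
  open Coefficients (fieldScalars F)
  open ≡.≡-Reasoning

  module _ (θ-power : ∀ z j → ∃[ w ] ⟦ z F.^ k ⟧ G.* θ G.^ j ≡ w G.^ k′) where

    isSum-θ : ∀ j s {x} → F.IsSum s x → G.IsSum s (⟦ x ⟧ G.* θ G.^ j)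
    isSum-θ j zero refl = trans (cong (G._* θ G.^ j) 0-homo) (G.zeroˡ _)
    isSum-θ j (suc s) (y , z , refl , zΣ) =
      let w , eq = θ-power y j
      in  w , ⟦ z ⟧ G.* θ G.^ j ,
          trans (cong (G._* θ G.^ j) (+-homo (y F.^ k) z))
                (trans (G.distribʳ (θ G.^ j) _ ⟦ z ⟧) (cong (G._+ ⟦ z ⟧ G.* θ G.^ j) eq)) ,
          isSum-θ j s zΣ

    isSum-eval : ∀ {s} → F.AllSums s → ∀ {u} (v : Vec (Fin q) u) → G.IsSum (u ℕ.* s) (eval θ v)
    isSum-eval allSums [] = refl
    isSum-eval {s} allSums {suc u} (x ∷ v) = G.isSum-+ (isSum-θ u s (allSums x)) (isSum-eval allSums v)

  -- A ledger for the lower bound: every coordinate records how many k-th powers it uses, and the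
  -- total is compared with the number of k′-th powers.
  data Summands : ∀ {u} → Vec (Fin q) u → Vec ℕ u → Set where
    []  : Summands [] []
    _∷_ : ∀ {u s x} {v : Vec (Fin q) u} {ss} → F.IsSum s x → Summands v ss → Summands (x ∷ v) (s ∷ ss)

  add-summand : ∀ {u} z j → j < u → ∀ {v : Vec (Fin q) u} {ss} → Summands v ss →
    ∃[ v′ ] ∃[ ss′ ] Summands v′ ss′ × eval {u} θ v′ ≡ ⟦ z F.^ k ⟧ G.* θ G.^ j G.+ eval θ v × Vec.sum ss′ ≡ suc (Vec.sum ss)
  add-summand {suc u} z j j<1+u {x ∷ v} {s ∷ ss} (xΣ ∷ vΣ) with ℕ.m≤n⇒m<n∨m≡n (ℕ.≤-pred j<1+u)
  -- The head of a vector of length `suc u` is the coefficient of θᵘ, so j = u changes the head and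
  -- j < u the tail.
  ... | inj₂ refl = (z F.^ k F.+ x) ∷ v , suc s ∷ ss , (z , x , refl , xΣ) ∷ vΣ , (begin
        ⟦ z F.^ k F.+ x ⟧ G.* θ G.^ u G.+ eval θ v
          ≡⟨ cong (λ y → y G.* θ G.^ u G.+ eval θ v) (+-homo (z F.^ k) x) ⟩
        (⟦ z F.^ k ⟧ G.+ ⟦ x ⟧) G.* θ G.^ u G.+ eval θ v       ≡⟨ cong (G._+ eval θ v) (G.distribʳ (θ G.^ u) _ _) ⟩
        ⟦ z F.^ k ⟧ G.* θ G.^ u G.+ ⟦ x ⟧ G.* θ G.^ u G.+ eval θ v     ≡⟨ G.+-assoc _ _ _ ⟩
        ⟦ z F.^ k ⟧ G.* θ G.^ u G.+ (⟦ x ⟧ G.* θ G.^ u G.+ eval θ v) ∎) , refl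
  ... | inj₁ j<u with add-summand z j j<u vΣ
  ...   | v′ , ss′ , v′Σ , eq , sum≡ = x ∷ v′ , s ∷ ss′ , xΣ ∷ v′Σ , (begin
        ⟦ x ⟧ G.* θ G.^ u G.+ eval θ v′                                    ≡⟨ cong (⟦ x ⟧ G.* θ G.^ u G.+_) eq ⟩
        ⟦ x ⟧ G.* θ G.^ u G.+ (⟦ z F.^ k ⟧ G.* θ G.^ j G.+ eval θ v)
          ≡⟨ G.solve 3 (λ a b c → a G.:+ (b G.:+ c) G.:= b G.:+ (a G.:+ c)) refl _ _ _ ⟩
        ⟦ z F.^ k ⟧ G.* θ G.^ j G.+ (⟦ x ⟧ G.* θ G.^ u G.+ eval θ v) ∎) ,
        trans (cong (s ℕ.+_) sum≡) (ℕ.+-suc s (Vec.sum ss))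

  module _ {b} (power-θ : ∀ w → ∃[ z ] ∃[ j ] j < b × w G.^ k′ ≡ ⟦ z F.^ k ⟧ G.* θ G.^ j) where

    collect : ∀ s {y} → G.IsSum s y → ∃[ v ] ∃[ ss ] Summands v ss × eval {b} θ v ≡ y × Vec.sum ss ≡ s
    collect zero refl = 𝟎 , Vec.replicate b 0 , no-summands b , eval-𝟎 b θ , sum-zeros b
      where
      no-summands : ∀ u → Summands (𝟎 {u}) (Vec.replicate u 0)
      no-summands zero    = []
      no-summands (suc u) = refl ∷ no-summands u
      sum-zeros : ∀ u → Vec.sum (Vec.replicate u 0) ≡ 0
      sum-zeros zero    = refl
      sum-zeros (suc u) = sum-zeros u
    collect (suc s) (w , y , refl , yΣ) =
      let v , ss , vΣ , v≡y , sum≡s = collect s yΣ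
          z , j , j<b , wᵏ≡ = power-θ w
          v′ , ss′ , v′Σ , v′≡ , sum≡ = add-summand z j j<b vΣ
      in  v′ , ss′ , v′Σ , trans v′≡ (cong₂ G._+_ (sym wᵏ≡) v≡y) , trans sum≡ (cong suc sum≡s)

  summands≥ : ∀ {g x u ss} → (∀ s → F.IsSum s x → g ≤ s) → Summands (Vec.replicate u x) ss → u ℕ.* g ≤ Vec.sum ss
  summands≥ {u = zero}  hard [] = z≤n
  summands≥ {u = suc u} hard (xΣ ∷ vΣ) = ℕ.+-mono-≤ (hard _ xΣ) (summands≥ hard vΣ)

  isLeast-* : ∀ {b} .{{_ : NonZero k}} → Independent b θ → (∀ y → ∃[ v ] eval {b} θ v ≡ y) →
    (∀ z j → ∃[ w ] ⟦ z F.^ k ⟧ G.* θ G.^ j ≡ w G.^ k′) →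
    (∀ w → ∃[ z ] ∃[ j ] j < b × w G.^ k′ ≡ ⟦ z F.^ k ⟧ G.* θ G.^ j) →
    ∀ {g} → IsLeast F.AllSums g → IsLeast G.AllSums (b ℕ.* g)
  isLeast-* {b} independent spanning θ-power power-θ {g} g-least@(allSums , _) =
    (λ y → let v , v≡y = spanning y in subst (G.IsSum (b ℕ.* g)) v≡y (isSum-eval θ-power allSums v)) ,
    λ s G-allSums →
      -- All b coordinates of the tested element are a hardest x; by independence the collected
      -- vector is this constant one, and each entry costs at least g.
      let x , hard = F.∃hardest g-least
          v , ss , vΣ , v≡ , sum≡s = collect power-θ s (G-allSums (eval θ (Vec.replicate b x)))
      in  subst (b ℕ.* g ≤_) sum≡s (summands≥ hard (subst (λ v → Summands v ss) (independent v≡) vΣ))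

-- Nonzero k-th and k′-th powers as powers of ζ and θ.

module PowersOfGenerator {q} (K : FieldOn q) {k c} .{{_ : NonZero k}} (q-1≡ : q ∸ 1 ≡ k ℕ.* c) where
  open FieldOn K
  open FieldProperties K

  generator : Fin q
  generator = proj₁ (∃hasOrder (q ∸ 1) ∣-refl)

  ζ : Fin q
  ζ = generator ^ k

  generates : ∀ {x} → x ≢ 0# → ∃[ i ] generator ^ i ≡ x
  generates x≢0 = ≡1⇒∃^ (q ∸ 1) {{q-1≢0}} (proj₂ (∃hasOrder (q ∸ 1) ∣-refl)) (x^[q-1]≡1 x≢0)

  ζ-order : HasOrder ζ c
  ζ-order = hasOrder-^ k (subst (HasOrder generator) q-1≡ (proj₂ (∃hasOrder (q ∸ 1) ∣-refl)))

-- The image of ζ and θᵇ both have order c, so they generate the same group.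
module PowersOverExtension
  {q Q k k′ b c} {F : FieldOn q} {G : FieldOn Q} (φ : Embedding (fieldScalars F) G)
  .{{_ : NonZero k}} .{{_ : NonZero k′}} .{{_ : NonZero b}} .{{_ : NonZero c}}
  (q-1≡ : q ∸ 1 ≡ k ℕ.* c) (Q-1≡ : Q ∸ 1 ≡ k′ ℕ.* (b ℕ.* c))
  where
  private
    module F where
      open FieldOn F public
      open FieldProperties F public
    module G where
      open FieldOn G public
      open FieldProperties G public
  open Embedding φ
  open ≡.≡-Reasoning

  private
    φ-^ : ∀ x n → ⟦ x F.^ n ⟧ ≡ ⟦ x ⟧ G.^ n
    φ-^ x zero    = 1-homo
    φ-^ x (suc n) = trans (*-homo x _) (cong (⟦ x ⟧ G.*_) (φ-^ x n))

  open PowersOfGenerator F q-1≡ using (ζ; ζ-order)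
    renaming (generator to g; generates to g-generates)
  open PowersOfGenerator G Q-1≡ using ()
    renaming (generator to γ; ζ to θ; generates to γ-generates; ζ-order to θ-order)

  φζ-order : G.HasOrder ⟦ ζ ⟧ c
  φζ-order = trans (sym (φ-^ ζ c)) (trans (cong ⟦_⟧ (proj₁ ζ-order)) 1-homo) ,
    λ j eq → proj₂ ζ-order j (injective (trans (φ-^ ζ j) (trans eq (sym 1-homo))))

  θᵇ-order : G.HasOrder (θ G.^ b) c
  θᵇ-order = G.hasOrder-^ b θ-order

  -- For z = gⁱ the k-th power is ζⁱ, whose image is a power of θᵇ; the product is thus a power of θ
  -- = γ ^ k′.
  θ-power : ∀ z j → ∃[ w ] ⟦ z F.^ k ⟧ G.* θ G.^ j ≡ w G.^ k′
  θ-power z j with z ≟ F.0#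
  ... | yes refl = G.0# , (begin
      ⟦ F.0# F.^ k ⟧ G.* θ G.^ j  ≡⟨ cong (λ x → ⟦ x ⟧ G.* θ G.^ j) (F.0^n≡0 k) ⟩
      ⟦ F.0# ⟧ G.* θ G.^ j        ≡⟨ cong (G._* θ G.^ j) 0-homo ⟩
      G.0# G.* θ G.^ j            ≡⟨ G.zeroˡ _ ⟩
      G.0#                        ≡⟨ G.0^n≡0 k′ ⟨
      G.0# G.^ k′ ∎)
  ... | no z≢0 =
    let i , gⁱ≡z = g-generates z≢0
        l , θᵇˡ≡φζ = G.≡1⇒∃^ c θᵇ-order (proj₁ φζ-order)
    in  γ G.^ (b ℕ.* (l ℕ.* i) ℕ.+ j) , (begin
      ⟦ z F.^ k ⟧ G.* θ G.^ j                   ≡⟨ cong (λ x → ⟦ x F.^ k ⟧ G.* θ G.^ j) gⁱ≡z ⟨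
      ⟦ (g F.^ i) F.^ k ⟧ G.* θ G.^ j           ≡⟨ cong (λ x → ⟦ x ⟧ G.* θ G.^ j) (F.^-swap g i k) ⟩
      ⟦ ζ F.^ i ⟧ G.* θ G.^ j                   ≡⟨ cong (G._* θ G.^ j) (φ-^ ζ i) ⟩
      ⟦ ζ ⟧ G.^ i G.* θ G.^ j                   ≡⟨ cong (λ x → x G.^ i G.* θ G.^ j) θᵇˡ≡φζ ⟨
      ((θ G.^ b) G.^ l) G.^ i G.* θ G.^ j
        ≡⟨ cong (G._* θ G.^ j) (trans (G.^-assocʳ (θ G.^ b) l i) (G.^-assocʳ θ b (l ℕ.* i))) ⟩
      θ G.^ (b ℕ.* (l ℕ.* i)) G.* θ G.^ j       ≡⟨ G.^-homo-* θ (b ℕ.* (l ℕ.* i)) j ⟨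
      θ G.^ (b ℕ.* (l ℕ.* i) ℕ.+ j)             ≡⟨ G.^-swap γ k′ (b ℕ.* (l ℕ.* i) ℕ.+ j) ⟩
      (γ G.^ (b ℕ.* (l ℕ.* i) ℕ.+ j)) G.^ k′ ∎)

  power-θ : ∀ w → ∃[ z ] ∃[ j ] j < b × w G.^ k′ ≡ ⟦ z F.^ k ⟧ G.* θ G.^ j
  power-θ w with w ≟ G.0#
  ... | yes refl = F.0# , 0 , ℕ.>-nonZero⁻¹ b , sym (begin
      ⟦ F.0# F.^ k ⟧ G.* G.1#     ≡⟨ G.*-identityʳ _ ⟩
      ⟦ F.0# F.^ k ⟧              ≡⟨ cong ⟦_⟧ (F.0^n≡0 k) ⟩
      ⟦ F.0# ⟧                    ≡⟨ 0-homo ⟩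
      G.0#                        ≡⟨ G.0^n≡0 k′ ⟨
      G.0# G.^ k′ ∎)
  ... | no w≢0 =
    let i , γⁱ≡w = γ-generates w≢0
        m , φζᵐ≡θᵇ = G.≡1⇒∃^ c φζ-order (proj₁ θᵇ-order)
        -- The remainder of i modulo b selects the coordinate, and the remaining factor (θᵇ)ᵈ is the
        -- image of a power of ζ.
        d = i ℕ./ b
    in  g F.^ (m ℕ.* d) , i ℕ.% b , m%n<n i b , (begin
      w G.^ k′                                      ≡⟨ cong (G._^ k′) γⁱ≡w ⟨
      (γ G.^ i) G.^ k′                              ≡⟨ G.^-swap γ i k′ ⟩
      θ G.^ i                                       ≡⟨ cong (θ G.^_) (m≡m%n+[m/n]*n i b) ⟩
      θ G.^ (i ℕ.% b ℕ.+ d ℕ.* b)                   ≡⟨ G.^-homo-* θ (i ℕ.% b) (d ℕ.* b) ⟩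
      θ G.^ (i ℕ.% b) G.* θ G.^ (d ℕ.* b)           ≡⟨ G.*-comm _ _ ⟩
      θ G.^ (d ℕ.* b) G.* θ G.^ (i ℕ.% b)           ≡⟨ cong (G._* θ G.^ (i ℕ.% b)) (begin
        θ G.^ (d ℕ.* b)             ≡⟨ G.^-assocʳ θ d b ⟨
        (θ G.^ d) G.^ b             ≡⟨ G.^-swap θ d b ⟩
        (θ G.^ b) G.^ d             ≡⟨ cong (G._^ d) φζᵐ≡θᵇ ⟨
        (⟦ ζ ⟧ G.^ m) G.^ d         ≡⟨ G.^-assocʳ ⟦ ζ ⟧ m d ⟩
        ⟦ ζ ⟧ G.^ (m ℕ.* d)         ≡⟨ φ-^ ζ (m ℕ.* d) ⟨
        ⟦ ζ F.^ (m ℕ.* d) ⟧         ≡⟨ cong ⟦_⟧ (F.^-swap g k (m ℕ.* d)) ⟩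
        ⟦ (g F.^ (m ℕ.* d)) F.^ k ⟧ ∎) ⟩
      ⟦ (g F.^ (m ℕ.* d)) F.^ k ⟧ G.* θ G.^ (i ℕ.% b) ∎)

-- From an abstract finite field to its copy on `Fin q` and back.

module Transport {c ℓ₁ ℓ₂ q} (F : FiniteField c ℓ₁ ℓ₂ q) where
  private module F where
    open HeytingField (FiniteField.heytingField F) public using (#-irrefl; invertible⇒#; #⇒invertible; tight)
    open CommutativeRing (FiniteField.commutativeRing F) public
    open RawSemiringDefs (Semiring.rawSemiring semiring) public using (_^_; sum)
    open Exp (CommutativeRing.commutativeSemiring (FiniteField.commutativeRing F)) public using (^-congˡ)
  open F using (Carrier; _≈_)
  open Inverse (FiniteField.enumeration F)
  open import Relation.Binary.Reasoning.Setoid F.setoid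

  private
    R : RawRing _ _
    R = record
      { Carrier = Fin q
      ; _≈_ = _≡_
      ; _+_ = λ x y → to (from x F.+ from y)
      ; _*_ = λ x y → to (from x F.* from y)
      ; -_  = λ x → to (F.- from x)
      ; 0#  = to F.0#
      ; 1#  = to F.1#
      }

    from-injective : ∀ {x y} → from x ≈ from y → x ≡ y
    from-injective {x} {y} eq = trans (sym (strictlyInverseˡ x)) (trans (to-cong eq) (strictlyInverseˡ y))

    isRingMonomorphism : IsRingMonomorphism R F.rawRing from
    isRingMonomorphism = record
      { isRingHomomorphism = record
        { isSemiringHomomorphism = record
          { isNearSemiringHomomorphism = record
            { +-isMonoidHomomorphism = record
              { isMagmaHomomorphism = record
                { isRelHomomorphism = record { cong = from-cong }
                ; homo = λ _ _ → strictlyInverseʳ _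
                }
              ; ε-homo = strictlyInverseʳ _
              }
            ; *-homo = λ _ _ → strictlyInverseʳ _
            }
          ; 1#-homo = strictlyInverseʳ _
          }
        ; -‿homo = λ _ → strictlyInverseʳ _
        }
      ; injective = from-injective
      }

    0≢ : ∀ {x} → x ≢ to F.0# → ¬ (from x ≈ F.0#)
    0≢ x≢0 fx≈0 = x≢0 (from-injective (F.trans fx≈0 (F.sym (strictlyInverseʳ F.0#))))

  onFin : FieldOn q
  onFin = record
    { _+_ = RawRing._+_ R
    ; _*_ = RawRing._*_ R
    ; -_  = RawRing.-_ R
    ; 0#  = RawRing.0# R
    ; 1#  = RawRing.1# R
    ; isCommutativeRing = RingMonomorphism.isCommutativeRing isRingMonomorphism F.isCommutativeRing
    ; 1≢0 = λ 1≡0 → F.#-irrefl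
        (F.trans (F.sym (strictlyInverseʳ F.1#)) (F.trans (from-cong 1≡0) (strictlyInverseʳ F.0#)))
        (F.invertible⇒# (F.1# , 1[1-0]≈1 , F.trans (F.*-comm _ _) 1[1-0]≈1))
    -- Tightness turns x ≢ 0 only into a doubly negated apartness; the search for an inverse is
    -- decidable, which removes the negations.
    ; inverse = λ x x≢0 → decidable-stable (any? (λ y → to (from x F.* from y) ≟ to F.1#)) λ none →
        0≢ x≢0 (proj₁ (F.tight (from x) F.0#) λ x#0 → none (inv x (F.#⇒invertible x#0)))
    }
    where
    x-0≈x : ∀ x → x F.- F.0# ≈ x
    x-0≈x x = F.trans (F.+-cong F.refl (RingProperties.-0#≈0# F.ring)) (F.+-identityʳ x)
    1[1-0]≈1 : F.1# F.* (F.1# F.- F.0#) ≈ F.1#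
    1[1-0]≈1 = F.trans (F.*-identityˡ _) (x-0≈x F.1#)
    inv : ∀ x → (∃[ y ] y F.* (from x F.- F.0#) ≈ F.1# × (from x F.- F.0#) F.* y ≈ F.1#) →
          ∃[ y ] to (from x F.* from y) ≡ to F.1#
    inv x (y , _ , xy≈1) = to y , to-cong (F.trans
      (F.*-cong (F.sym (x-0≈x (from x))) (strictlyInverseʳ y)) xy≈1)

  private module F′ = FieldOn onFin

  from-^ : ∀ x n → from (x F′.^ n) ≈ from x F.^ n
  from-^ x zero    = strictlyInverseʳ F.1#
  from-^ x (suc n) = F.trans (strictlyInverseʳ _) (F.*-cong F.refl (from-^ x n))

  module _ (k : ℕ) where
    open PowerSums onFin k

    isSum⇒sum : ∀ s {x} → IsSum s x → Σ[ y ∈ Vector Carrier s ] from x ≈ F.sum (λ i → y i F.^ k)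
    isSum⇒sum zero    refl = (λ ()) , strictlyInverseʳ F.0#
    isSum⇒sum (suc s) (y , z , refl , zΣ) =
      let w , z≈ = isSum⇒sum s zΣ
      in  (λ { zero → from y ; (suc i) → w i }) ,
          F.trans (strictlyInverseʳ _) (F.+-cong (from-^ y k) z≈)

    sum⇒isSum : ∀ s {x} (y : Vector Carrier s) → from x ≈ F.sum (λ i → y i F.^ k) → IsSum s x
    sum⇒isSum zero    y x≈ = from-injective (F.trans x≈ (F.sym (strictlyInverseʳ F.0#)))
    sum⇒isSum (suc s) {x} y x≈ = to (y zero) , to rest , from-injective (begin
        from x                                       ≈⟨ x≈ ⟩
        y zero F.^ k F.+ rest                        ≈⟨ F.+-cong (F.^-congˡ k (strictlyInverseʳ (y zero))) (strictlyInverseʳ rest) ⟨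
        from (to (y zero)) F.^ k F.+ from (to rest)  ≈⟨ F.+-cong (from-^ (to (y zero)) k) F.refl ⟨
        from (to (y zero) F′.^ k) F.+ from (to rest) ≈⟨ strictlyInverseʳ _ ⟨
        from (to (y zero) F′.^ k F′.+ to rest) ∎) ,
      sum⇒isSum s (y ∘ suc) (strictlyInverseʳ rest)
      where rest = F.sum (λ i → y (suc i) F.^ k)

    isLeast⇒isWaringNumber : ∀ {g} → IsLeast AllSums g → IsWaringNumber F k g
    isLeast⇒isWaringNumber {g} (allSums , minimal) =
      (λ x → let y , eq = isSum⇒sum g (allSums (to x)) in y , F.trans (F.sym (strictlyInverseʳ x)) eq) ,
      λ s every → minimal s λ x → let y , eq = every (from x) in sum⇒isSum s y eq

-- Bases generated by ζ and θ, and the theorem.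

module _ {p} (p-prime : Prime p) where
  private instance _ = prime⇒nonZero p-prime

  module _
    {q a k c} {F : FieldOn q} (ι : Embedding (modularScalars p) F)
    (q≡pᵃ : q ≡ p ℕ.^ a) .{{_ : NonZero k}} .{{_ : NonZero c}} (q-1≡ : q ∸ 1 ≡ k ℕ.* c)
    (c-primitive : ∀ u → 1 ≤ u → u < a → ¬ c ∣ p ℕ.^ u ∸ 1)
    where
    open FieldOn F
    open FieldProperties F
    open PowersOfGenerator F q-1≡
    open PowerSums F k
    open Embedding ι
    open Evaluation ι

    -- The order c of ζ divides pᵘ - 1, so primitivity leaves u ≥ a, and pᵘ independent combinations
    -- exhaust the q elements.
    ζ-spanning : ∀ {u} .{{_ : NonZero u}} → Independent u ζ → (μ : Vec _ u) → ζ ^ u ≡ eval ζ μ →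
                 ∀ y → ∃[ v ] eval {u} ζ v ≡ y
    ζ-spanning {u} independent μ ζᵘ≡μ = independent⇒spanning independent
      (subst (_≤ p ℕ.^ u) (sym q≡pᵃ) (ℕ.^-monoʳ-≤ p (ℕ.≮⇒≥ λ u<a →
        c-primitive u (ℕ.>-nonZero⁻¹ u) u<a
          (proj₂ ζ-order _ (span-lagrange (hasOrder⇒≢0 c ζ-order) independent μ ζᵘ≡μ)))))

    -- This bounds g(k, q): a term d ζᵘ consists of d < p copies of the k-th power of
    -- `generator ^ u`.
    isSum-eval-ζ : (∀ d → ⟦ d ⟧ ≡ toℕ d · 1#) → ∀ {u} (v : Vec _ u) → IsSum (u ℕ.* p) (eval ζ v)
    isSum-eval-ζ ⟦⟧≡ [] = refl
    isSum-eval-ζ ⟦⟧≡ {suc u} (d ∷ v) = isSum-+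
      (subst (IsSum p) (sym term) (isSum-mono (ℕ.<⇒≤ (toℕ<n d)) (isSum-· (toℕ d) (generator ^ u))))
      (isSum-eval-ζ ⟦⟧≡ v)
      where
      open ≡.≡-Reasoning
      term : ⟦ d ⟧ * ζ ^ u ≡ toℕ d · ((generator ^ u) ^ k)
      term = begin
        ⟦ d ⟧ * ζ ^ u                     ≡⟨ cong (_* ζ ^ u) (⟦⟧≡ d) ⟩
        toℕ d · 1# * ζ ^ u                ≡⟨ ×-assoc-* (toℕ d) 1# (ζ ^ u) ⟩
        toℕ d · (1# * ζ ^ u)              ≡⟨ cong (toℕ d ·_) (*-identityˡ _) ⟩
        toℕ d · (ζ ^ u)                   ≡⟨ cong (toℕ d ·_) (^-swap generator k u) ⟩
        toℕ d · ((generator ^ u) ^ k) ∎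

relation-nonZero : ∀ {n q} {R : Scalars n} {K : FieldOn q} (ι : Embedding R K) →
  let open FieldOn K; open Evaluation ι in
  ∀ {x u} (μ : Vec (Fin n) u) → x ^ u ≡ eval x μ → NonZero u
relation-nonZero {K = K} ι [] 1≡0 = contradiction 1≡0 (FieldOn.1≢0 K)
relation-nonZero ι (_ ∷ _) _ = _

module _
  {q Q k k′ b c} {F : FieldOn q} {G : FieldOn Q} (φ : Embedding (fieldScalars F) G)
  .{{_ : NonZero k}} .{{_ : NonZero k′}} .{{_ : NonZero b}} .{{_ : NonZero c}}
  (q-1≡ : q ∸ 1 ≡ k ℕ.* c) (Q-1≡ : Q ∸ 1 ≡ k′ ℕ.* (b ℕ.* c)) (Q≡qᵇ : Q ≡ q ℕ.^ b)
  (∣⇒b∣ : ∀ u → b ℕ.* c ∣ q ℕ.^ u ∸ 1 → b ∣ u)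
  where
  open FieldOn G
  open FieldProperties G
  open PowersOfGenerator G Q-1≡ renaming (ζ to θ; ζ-order to θ-order)
  open Evaluation φ

  -- The degree n is a positive multiple of b, and counting gives qⁿ ≤ Q = qᵇ; so n = b, and the
  -- independent combinations fill the field.
  θ-basis : Independent b θ × (∀ y → ∃[ v ] eval {b} θ v ≡ y)
  θ-basis = fromRelation (minimalRelation θ)
    where
    module _ {n} (independent : Independent n θ) (ν : Vec _ n) (θⁿ≡ν : θ ^ n ≡ eval θ ν) where
      instance _ = relation-nonZero φ ν θⁿ≡ν
      b∣n : b ∣ n
      b∣n = ∣⇒b∣ n (proj₂ θ-order _
        (span-lagrange (hasOrder⇒≢0 (b ℕ.* c) {{ℕ.m*n≢0 b c}} θ-order) independent ν θⁿ≡ν))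
      1<q : 1 < q
      1<q = ℕ.m∸n≢0⇒n<m (ℕ.≢-nonZero⁻¹ (q ∸ 1) {{FieldProperties.q-1≢0 F}})
      n≤b : n ≤ b
      n≤b = ℕ.≮⇒≥ λ b<n → ℕ.<⇒≱ (ℕ.^-monoʳ-< q 1<q b<n) (subst (q ℕ.^ n ≤_) Q≡qᵇ (independent⇒≤ independent))
      n≡b : n ≡ b
      n≡b = ℕ.≤-antisym n≤b (∣⇒≤ b∣n)
    fromRelation : (∃[ n ] Independent n θ × ∃[ ν ] θ ^ n ≡ eval {n} θ ν) →
                   Independent b θ × (∀ y → ∃[ v ] eval {b} θ v ≡ y)
    fromRelation (n , independent , ν , θⁿ≡ν) = independentᵇ ,
      independent⇒spanning independentᵇ (ℕ.≤-reflexive Q≡qᵇ)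
      where
      independentᵇ : Independent b θ
      independentᵇ = subst (λ n → Independent n θ) (n≡b independent ν θⁿ≡ν) independent

  isLeast-allSums : ∀ {w} → IsLeast (PowerSums.AllSums F k) w → IsLeast (PowerSums.AllSums G k′) (b ℕ.* w)
  isLeast-allSums = SumsOverExtension.isLeast-* {F = F} φ θ (proj₁ θ-basis) (proj₂ θ-basis)
    (PowersOverExtension.θ-power {F = F} φ q-1≡ Q-1≡) (PowersOverExtension.power-θ {F = F} φ q-1≡ Q-1≡)

waringNumber-* :
  ∀ {p} a A b {q Q k k′ c} → Prime p → q ≡ p ℕ.^ a → Q ≡ p ℕ.^ A → Q ≡ q ℕ.^ b →
  .{{_ : NonZero k}} .{{_ : NonZero k′}} .{{_ : NonZero b}} .{{_ : NonZero c}} →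
  q ∸ 1 ≡ k ℕ.* c → Q ∸ 1 ≡ k′ ℕ.* (b ℕ.* c) →
  (∀ u → 1 ≤ u → u < a → ¬ c ∣ p ℕ.^ u ∸ 1) →
  (∀ u → b ℕ.* c ∣ q ℕ.^ u ∸ 1 → b ∣ u) →
  (F : FieldOn q) (G : FieldOn Q) →
  ∃[ w ] IsLeast (PowerSums.AllSums F k) w × IsLeast (PowerSums.AllSums G k′) (b ℕ.* w)
waringNumber-* {p} a A b {q} {Q} {k} {k′} {c} p-prime q≡pᵃ Q≡pᴬ Q≡qᵇ q-1≡ Q-1≡ c-primitive ∣⇒b∣ F G
  with PrimeField.primeEmbedding p-prime a q≡pᵃ F | PrimeField.primeEmbedding p-prime A Q≡pᴬ G
... | ιF , ⟦⟧≡ | ιG , _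
  with Evaluation.minimalRelation ιF (PowersOfGenerator.ζ F q-1≡)
... | u , independent , μ , ζᵘ≡μ = w , w-least , isLeast-allSums φ q-1≡ Q-1≡ Q≡qᵇ ∣⇒b∣ w-least
  where
  module F = FieldProperties F
  open PowersOfGenerator F q-1≡ using (ζ; ζ-order)
  instance _ = relation-nonZero ιF μ ζᵘ≡μ
  spanning : ∀ y → ∃[ v ] Evaluation.eval ιF {u} ζ v ≡ y
  spanning = ζ-spanning p-prime ιF q≡pᵃ q-1≡ c-primitive independent μ ζᵘ≡μ
  φ : Embedding (fieldScalars F) G
  φ = Extension.extension ιF ιG ζ (F.hasOrder⇒≢0 c ζ-order) independent μ ζᵘ≡μ spanning
    -- A root of the minimal polynomial of ζ exists in the larger field because c divides Q - 1.
    (F.^-∣-≡1 (subst (c ∣_) (sym Q-1≡) (∣-trans (n∣m*n b) (n∣m*n k′))) (proj₁ ζ-order))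
  open PowerSums F k using (AllSums; IsSum; allSums?)
  exists : ∃[ w ] IsLeast AllSums w
  exists = least allSums? (u ℕ.* p) λ y → let v , v≡y = spanning y in
    subst (IsSum (u ℕ.* p)) v≡y (isSum-eval-ζ p-prime ιF q≡pᵃ q-1≡ c-primitive ⟦⟧≡ v)
  w = proj₁ exists
  w-least = proj₂ exists

open import Data.Nat.Base using (_*_; _^_; _/_)
open import Data.Nat.Properties using (*-comm; *-assoc; ^-*-assoc; m^n≢0; m*n≢0; m*n≢0⇒m≢0)
open ≡.≡-Reasoning

mainTheorem15 : ∀ {f₁ f₂ f₃ k₁ k₂ k₃}
    (p a c : ℕ) .{{_ : NonZero a}} .{{_ : NonZero c}} →
    Prime p →
    IsPrimitiveDivisor c p a →
    (s t : ℕ) (r e : Vector ℕ s) →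
    1 ≤ s →
    (r-prime : ∀ i → Prime (r i)) →
    (∀ i → r i ≢ 2) →
    Injective _≡_ _≡_ r →
    (∀ i → 1 ≤ e i) →
    let b′ = primePowers r e
        b  = 2 ^ t * b′
    in
    gcd p b ≡ 1 →
    gcd ((p ^ a ∸ 1) / c) b ≡ 1 →
    (∀ i → ∃[ h ] (h ≤ e i ∸ 1 × IsMultiplicativeOrder (p ^ a) (r i ^ e i) (r i ^ h))) →
    (t ≡ 0 ⊎ t ≡ 1) ⊎ (2 ≤ t × p ^ a ≡ 1 [mod 4 ]) →
    (F : FiniteField f₁ f₂ f₃ (p ^ a)) →
    (K : FiniteField k₁ k₂ k₃ (p ^ (2 ^ t * a * b′))) →
    ∃[ g ] (IsWaringNumber F ((p ^ a ∸ 1) / c) g ×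
            IsWaringNumber K (_/_ (p ^ (2 ^ t * a * b′) ∸ 1) (2 ^ t * b′ * c) {{denominator≢0 t r e c r-prime}}) (2 ^ t * b′ * g))
mainTheorem15 p a c p-prime (c∣pᵃ-1 , c-primitive) s t r e _ r-prime r≢2 r-injective e≥1
  p⊥b k⊥b order-rʰ 2-condition F K =
  let w , F-least , K-least =
        waringNumber-* a (2 ^ t * a * b′) b {k = k} {k′ = k′} {c = c} p-prime refl refl Q≡qᵇ q-1≡ Q-1≡ c-primitive bc∣⇒b∣
          F.onFin K.onFin
  in  w , F.isLeast⇒isWaringNumber k F-least , K.isLeast⇒isWaringNumber k′ K-least
  where
  module F = Transport F
  module K = Transport K
  b′ = primePowers r e
  b  = 2 ^ t * b′
  q  = p ^ a
  Q  = p ^ (2 ^ t * a * b′)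
  instance
    _ = prime⇒nonZero p-prime
    _ = primePowers≢0 r e r-prime
    _ = m^n≢0 2 t
    _ = m*n≢0 (2 ^ t) b′
    _ = denominator≢0 t r e c r-prime
    _ = m^n≢0 p a
  k  = (q ∸ 1) / c
  k′ = (Q ∸ 1) / (b * c)

  -- For t ≥ 1 the number b is even, and p is prime to b.
  odd : 1 ≤ t → 2 ∤ q
  odd (s≤s {n = t-1} _) 2∣q = contradiction
    (gcd≡1⇒coprime {m = p} {n = b} p⊥b (prime∣^⇒∣ a prime[2] 2∣q , ∣m⇒∣m*n b′ (m∣m*n (2 ^ t-1)))) λ ()

  q-1≡ : q ∸ 1 ≡ k * c
  q-1≡ = sym (m/n*n≡m c∣pᵃ-1)

  Q≡qᵇ : Q ≡ q ^ b
  Q≡qᵇ = begin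
    p ^ (2 ^ t * a * b′)    ≡⟨ cong (λ x → p ^ (x * b′)) (*-comm (2 ^ t) a) ⟩
    p ^ (a * 2 ^ t * b′)    ≡⟨ cong (p ^_) (*-assoc a (2 ^ t) b′) ⟩
    p ^ (a * b)             ≡⟨ ^-*-assoc p a b ⟨
    q ^ b ∎

  qᵘ-1≡ : ∀ u → q ^ u ∸ 1 ≡ k * geometricSum q u * c
  qᵘ-1≡ u = begin
    q ^ u ∸ 1                          ≡⟨ ^∸1 q u ⟩
    (q ∸ 1) * geometricSum q u         ≡⟨ cong (_* geometricSum q u) q-1≡ ⟩
    k * c * geometricSum q u           ≡⟨ *-assoc k c _ ⟩
    k * (c * geometricSum q u)         ≡⟨ cong (k *_) (*-comm c _) ⟩
    k * (geometricSum q u * c)         ≡⟨ *-assoc k _ c ⟨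
    k * geometricSum q u * c ∎
    where
    ^∸1 : ∀ q u → .{{NonZero q}} → q ^ u ∸ 1 ≡ (q ∸ 1) * geometricSum q u
    ^∸1 (suc x) u = cong (_∸ 1) (suc-^ x u)

  bc∣⇒b∣ : ∀ u → b * c ∣ q ^ u ∸ 1 → b ∣ u
  bc∣⇒b∣ u bc∣ = ∣geometricSum⇒∣ᵇ q t r e r-prime r≢2 r-injective e≥1 order-rʰ 2-condition odd u
    (coprime-divisor {n = k} (Coprimality.sym (gcd≡1⇒coprime {m = k} {n = b} k⊥b))
      (*-cancelʳ-∣ c (subst (b * c ∣_) (qᵘ-1≡ u) bc∣)))

  Q-1≡ : Q ∸ 1 ≡ k′ * (b * c)
  Q-1≡ = sym (m/n*n≡m (subst (b * c ∣_) (sym (trans (cong (_∸ 1) Q≡qᵇ) (qᵘ-1≡ b)))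
    (*-monoˡ-∣ c (∣n⇒∣m*n k (∣geometricSumᵇ q t r e r-prime r≢2 r-injective e≥1 order-rʰ 2-condition odd)))))

  instance
    k≢0 : NonZero k
    k≢0 = m*n≢0⇒m≢0 k {{subst NonZero q-1≡ (FieldProperties.q-1≢0 F.onFin)}}
    k′≢0 : NonZero k′
    k′≢0 = m*n≢0⇒m≢0 k′ {{subst NonZero Q-1≡ (FieldProperties.q-1≢0 K.onFin)}}
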